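{- There is a linear-time many-one reduction that transforms every sentence $\Psi$ of two-variable first-order logic with the equality predicate of the form $$\Psi=\forall x\,\gamma(x)\wedge\forall x\forall y\,(x\neq y\to\alpha(x,y))\wedge\bigwedge_{i=1}^m\forall x\exists y\,\bigl(\beta_i(x,y)\wedge x\neq y\bigr),$$ where $\gamma,\alpha$ are quantifier-free and equality-free and each $\beta_i$ is an atomic binary predicate, into a two-variable sentence $\Psi^*$ without the equality predicate such that $\Psi$ is satisfiable if and only if $\Psi^*$ is satisfiable. The reduction increases the number of predicates by at most a constant factor: if $\Psi$ uses $n$ unary and $k$ binary predicates, then $\Psi^*$ uses $O(n+k)$ predicates.
   Context: $\mathrm{FO}^2$ is the fragment of relational first-order logic using only the two variables $x,y$; only unary and binary predicates (and possibly equality) are used, with no constant symbols. Here $m\ge 1$ and $m\le k$, and atoms $R(x,x)$, $R(y,y)$ with $R$ binary are assumed not to occur (they are treated as unary predicates). Every $\mathrm{FO}^2$ sentence with equality can be rewritten into an equi-satisfiable sentence of the displayed form. -}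

module Defs where

open import Level using (0ℓ)
open import Data.Bool.Base using (Bool)
import Data.Bool.Properties as Bool
open import Data.Empty using (⊥)
open import Data.Fin.Base using (Fin; zero; suc)
open import Data.List.Base as List
  using (List; []; _∷_; [_]; _++_; _∷ʳ_; length; map; mapMaybe; deduplicate)
import Data.List.Properties as List
open import Data.List.NonEmpty.Base as List⁺ using (List⁺)
open import Data.List.Relation.Unary.All using (All)
open import Data.Maybe.Base as Maybe using (Maybe; just; nothing)
open import Data.Nat.Base using (ℕ; suc; _+_; _*_; _≤_)
open import Data.Product as Product using (∃-syntax; _×_; _,_)
open import Data.Sum.Base using (_⊎_; inj₁)
open import Data.Unit.Base using (⊤)
open import Data.Vec.Base as Vec using (Vec; _∷_)
open import Function.Base using (_∘_)
open import Function.Bundles using (_↔_)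
open import Relation.Binary.Core using (Rel)
open import Relation.Binary.Definitions using (DecidableEquality)
open import Relation.Binary.PropositionalEquality using (_≡_; _≢_)
open import Relation.Nullary using (¬_)
open import Relation.Unary using (Pred)

------------------------------------------------------------------------
-- Syntax of FO²

data Var : Set where
  x y : Var

-- Predicate symbols are words over {0,1}; every word names one unary and one
-- (unrelated) binary predicate.

Name : Set
Name = List Bool

_≟-Name_ : DecidableEquality Name
_≟-Name_ = List.≡-dec Bool._≟_

data Atom : Set where
  unary  : Name → Var → Atom
  binary : Name → Var → Var → Atom
  equal  : Var → Var → Atom

infix  9 ¬ᶠ_
infixr 7 _∧ᶠ_
infixr 6 _∨ᶠ_
infixr 5 _⇒ᶠ_

data Formula : Set where
  atom            : Atom → Formula
  ⊤ᶠ ⊥ᶠ           : Formula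
  ¬ᶠ_             : Formula → Formula
  _∧ᶠ_ _∨ᶠ_ _⇒ᶠ_  : Formula → Formula → Formula
  ∀ᶠ ∃ᶠ           : Var → Formula → Formula

_≠ᶠ_ : Var → Var → Formula
u ≠ᶠ v = ¬ᶠ atom (equal u v)

_OccursIn_ : Var → Atom → Set
v OccursIn unary _ u     = v ≡ u
v OccursIn binary _ u u′ = v ≡ u ⊎ v ≡ u′
v OccursIn equal u u′    = v ≡ u ⊎ v ≡ u′

_FreeIn_ : Var → Formula → Set
v FreeIn atom a   = v OccursIn a
v FreeIn ⊤ᶠ       = ⊥
v FreeIn ⊥ᶠ       = ⊥
v FreeIn (¬ᶠ φ)   = v FreeIn φ
v FreeIn (φ ∧ᶠ ψ) = v FreeIn φ ⊎ v FreeIn ψ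
v FreeIn (φ ∨ᶠ ψ) = v FreeIn φ ⊎ v FreeIn ψ
v FreeIn (φ ⇒ᶠ ψ) = v FreeIn φ ⊎ v FreeIn ψ
v FreeIn ∀ᶠ u φ   = v ≢ u × v FreeIn φ
v FreeIn ∃ᶠ u φ   = v ≢ u × v FreeIn φ

IsSentence : Formula → Set
IsSentence φ = ∀ v → ¬ (v FreeIn φ)

QuantifierFree : Formula → Set
QuantifierFree (atom _)  = ⊤
QuantifierFree ⊤ᶠ        = ⊤
QuantifierFree ⊥ᶠ        = ⊤
QuantifierFree (¬ᶠ φ)    = QuantifierFree φ
QuantifierFree (φ ∧ᶠ ψ)  = QuantifierFree φ × QuantifierFree ψ
QuantifierFree (φ ∨ᶠ ψ)  = QuantifierFree φ × QuantifierFree ψ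
QuantifierFree (φ ⇒ᶠ ψ)  = QuantifierFree φ × QuantifierFree ψ
QuantifierFree (∀ᶠ _ _)  = ⊥
QuantifierFree (∃ᶠ _ _)  = ⊥

atoms : Formula → List Atom
atoms (atom a)  = [ a ]
atoms ⊤ᶠ        = []
atoms ⊥ᶠ        = []
atoms (¬ᶠ φ)    = atoms φ
atoms (φ ∧ᶠ ψ)  = atoms φ ++ atoms ψ
atoms (φ ∨ᶠ ψ)  = atoms φ ++ atoms ψ
atoms (φ ⇒ᶠ ψ)  = atoms φ ++ atoms ψ
atoms (∀ᶠ _ φ)  = atoms φ
atoms (∃ᶠ _ φ)  = atoms φ

EqualityFree : Formula → Set
EqualityFree φ = All (λ a → ∀ u v → a ≢ equal u v) (atoms φ)

-- No atoms R(x,x) or R(y,y) with R a binary predicate symbol.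

LoopFree : Formula → Set
LoopFree φ = All (λ a → ∀ R v → a ≢ binary R v v) (atoms φ)

unarySymbol : Atom → Maybe Name
unarySymbol (unary U _)    = just U
unarySymbol (binary _ _ _) = nothing
unarySymbol (equal _ _)    = nothing

binarySymbol : Atom → Maybe Name
binarySymbol (unary _ _)    = nothing
binarySymbol (binary R _ _) = just R
binarySymbol (equal _ _)    = nothing

-- Numbers of distinct predicate symbols used (equality is not counted).

#unary : Formula → ℕ
#unary φ = length (deduplicate _≟-Name_ (mapMaybe unarySymbol (atoms φ)))

#binary : Formula → ℕ
#binary φ = length (deduplicate _≟-Name_ (mapMaybe binarySymbol (atoms φ)))

------------------------------------------------------------------------
-- Semantics

record Structure : Set₁ where
  field
    Carrier  : Set
    nonempty : Carrier
    ⟦_⟧₁     : Name → Pred Carrier 0ℓ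
    ⟦_⟧₂     : Name → Rel Carrier 0ℓ

module _ (M : Structure) where
  open Structure M

  -- (a , b) assigns a to x and b to y.

  Assignment : Set
  Assignment = Carrier × Carrier

  value : Assignment → Var → Carrier
  value (a , b) x = a
  value (a , b) y = b

  update : Assignment → Var → Carrier → Assignment
  update (a , b) x c = c , b
  update (a , b) y c = a , c

  HoldsAtom : Assignment → Atom → Set
  HoldsAtom ρ (unary U v)    = ⟦ U ⟧₁ (value ρ v)
  HoldsAtom ρ (binary R u v) = ⟦ R ⟧₂ (value ρ u) (value ρ v)
  HoldsAtom ρ (equal u v)    = value ρ u ≡ value ρ v

  Holds : Assignment → Formula → Set
  Holds ρ (atom a)  = HoldsAtom ρ a
  Holds ρ ⊤ᶠ        = ⊤
  Holds ρ ⊥ᶠ        = ⊥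
  Holds ρ (¬ᶠ φ)    = ¬ Holds ρ φ
  Holds ρ (φ ∧ᶠ ψ)  = Holds ρ φ × Holds ρ ψ
  Holds ρ (φ ∨ᶠ ψ)  = Holds ρ φ ⊎ Holds ρ ψ
  Holds ρ (φ ⇒ᶠ ψ)  = Holds ρ φ → Holds ρ ψ
  Holds ρ (∀ᶠ v φ)  = ∀ c → Holds (update ρ v c) φ
  Holds ρ (∃ᶠ v φ)  = ∃[ c ] Holds (update ρ v c) φ

infix 4 _⊨_

_⊨_ : Structure → Formula → Set
M ⊨ φ = ∀ ρ → Holds M ρ φ

Satisfiable : Formula → Set₁
Satisfiable φ = ∃[ M ] M ⊨ φ

------------------------------------------------------------------------
-- The input sentences

displayed : Formula → Formula → List⁺ Name → Formula
displayed γ α β =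
     ∀ᶠ x γ
  ∧ᶠ ∀ᶠ x (∀ᶠ y (x ≠ᶠ y ⇒ᶠ α))
  ∧ᶠ List⁺.foldr₁ _∧ᶠ_
       (List⁺.map (λ βᵢ → ∀ᶠ x (∃ᶠ y (atom (binary βᵢ x y) ∧ᶠ x ≠ᶠ y))) β)

record DisplayedSentence : Set where
  field
    γ α : Formula
    β   : List⁺ Name

  sentence : Formula
  sentence = displayed γ α β

  field
    γ-quantifierFree : QuantifierFree γ
    γ-equalityFree   : EqualityFree γ
    γ-loopFree       : LoopFree γ
    γ-variables      : ¬ (y FreeIn γ)
    α-quantifierFree : QuantifierFree α
    α-equalityFree   : EqualityFree α
    α-loopFree       : LoopFree α
    m≤k              : List⁺.length β ≤ #binary sentence

open DisplayedSentence public using (sentence)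

------------------------------------------------------------------------
-- Formulas as words over a finite alphabet (Polish notation)

data Token : Set where
  var                               : Var → Token
  unary binary equal                : Token
  bit                               : Bool → Token
  end                               : Token
  true false neg conj disj imp      : Token
  forAll exists                     : Token

encodeName : Name → List Token
encodeName w = map bit w ∷ʳ end

encodeAtom : Atom → List Token
encodeAtom (unary U v)    = unary ∷ encodeName U ++ var v ∷ []
encodeAtom (binary R u v) = binary ∷ encodeName R ++ var u ∷ var v ∷ []
encodeAtom (equal u v)    = equal ∷ var u ∷ var v ∷ []

encode : Formula → List Token
encode (atom a)  = encodeAtom a
encode ⊤ᶠ        = [ true ]
encode ⊥ᶠ        = [ false ]
encode (¬ᶠ φ)    = neg ∷ encode φ
encode (φ ∧ᶠ ψ)  = conj ∷ encode φ ++ encode ψ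
encode (φ ∨ᶠ ψ)  = disj ∷ encode φ ++ encode ψ
encode (φ ⇒ᶠ ψ)  = imp ∷ encode φ ++ encode ψ
encode (∀ᶠ v φ)  = forAll ∷ var v ∷ encode φ
encode (∃ᶠ v φ)  = exists ∷ var v ∷ encode φ

------------------------------------------------------------------------
-- Deterministic multitape Turing machines

Finite : Set → Set
Finite A = ∃[ n ] (A ↔ Fin n)

data Move : Set where
  left right stay : Move

module _ (S : Set) where

  -- Tape symbols; nothing is the blank.

  Symbol : Set
  Symbol = Maybe S

  -- A two-way infinite tape, blank outside the recorded part.  The cells to
  -- the left of the head are listed from the head outwards.

  record Tape : Set where
    constructor tape
    field
      before : List Symbol
      head   : Symbol
      after  : List Symbol

module _ {S : Set} where
  open Tape

  blankTape : Tape S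
  blankTape = tape [] nothing []

  move : Move → Tape S → Tape S
  move left  (tape []       h rs)       = tape []       nothing (h ∷ rs)
  move left  (tape (l ∷ ls) h rs)       = tape ls       l       (h ∷ rs)
  move right (tape ls       h [])       = tape (h ∷ ls) nothing []
  move right (tape ls       h (r ∷ rs)) = tape (h ∷ ls) r       rs
  move stay  t                          = t

  act : Symbol S × Move → Tape S → Tape S
  act (s , d) t = move d (record t { head = s })

  -- A tape holding the word w, with the head on its first letter.

  load : List S → Tape S
  load []       = blankTape
  load (a ∷ w)  = tape [] (just a) (map just w)

  -- The non-blank part of the tape is exactly the word w; the position of the
  -- head is irrelevant.

  Contains : Tape S → List S → Set
  Contains t w = ∃[ i ] ∃[ j ]
    List.reverse (before t) ++ head t ∷ after t
      ≡ List.replicate i nothing ++ map just w ++ List.replicate j nothing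

-- Tape 0 is the input tape, tape 1 the output tape, the others are work tapes.
-- The machine halts when δ returns nothing.

record TuringMachine (A : Set) : Set₁ where
  field
    State       : Set
    stateFinite : Finite State
    Extra       : Set
    extraFinite : Finite Extra
    workTapes   : ℕ

  tapes : ℕ
  tapes = 2 + workTapes

  Letter : Set
  Letter = A ⊎ Extra

  field
    start : State
    δ     : State → Vec (Symbol Letter) tapes →
            Maybe (State × Vec (Symbol Letter × Move) tapes)

  Config : Set
  Config = State × Vec (Tape Letter) tapes

  step : Config → Maybe Config
  step (q , ts) =
    Maybe.map (Product.map₂ (λ as → Vec.zipWith act as ts))
              (δ q (Vec.map Tape.head ts))

  initial : List A → Config
  initial w = start , load (map inj₁ w) ∷ Vec.replicate _ blankTape

  -- c ⇓[ t ] c′ : started in c, the machine halts in c′ after exactly t steps.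

  data _⇓[_]_ : Config → ℕ → Config → Set where
    halt : ∀ {c} → step c ≡ nothing → c ⇓[ 0 ] c
    next : ∀ {c c′ c″ t} → step c ≡ just c′ → c′ ⇓[ t ] c″ → c ⇓[ suc t ] c″

  Computes_⟼_within_ : List A → List A → ℕ → Set
  Computes v ⟼ w within b =
    ∃[ t ] ∃[ q ] ∃[ ts ]
      t ≤ b
      × initial v ⇓[ t ] (q , ts)
      × Contains (Vec.lookup ts (suc zero)) (map inj₁ w)

-- The map i ↦ output i is computable in time linear in the length of the word
-- input i.

LinearTimeComputable : {I A : Set} (input output : I → List A) → Set₁
LinearTimeComputable {I} {A} input output =
  ∃[ M ] ∃[ c ] ∀ (i : I) →
    TuringMachine.Computes_⟼_within_ {A} M (input i) (output i)
      (c * length (input i))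

{-# OPTIONS --safe #-}
module Submission where

open import Defs
open import Axiom.ExcludedMiddle using (ExcludedMiddle)
open import Axiom.UniquenessOfIdentityProofs using (module Decidable⇒UIP)
open import Data.Bool.Base using (Bool; true; false; not; if_then_else_; T)
open import Data.Empty using (⊥; ⊥-elim)
open import Data.Fin.Properties using (0↔⊥; 1↔⊤; +↔⊎)
open import Data.List.Base using (List; []; _∷_; [_]; _++_; _∷ʳ_; _ʳ++_; cartesianProduct; concatMap; deduplicate; drop; foldr; head; length; map; mapMaybe; replicate; reverse; upTo)
open import Data.List.Membership.DecPropositional _≟-Name_ using (_∈?_)
open import Data.List.Membership.Propositional using (_∈_)
open import Data.List.Membership.Propositional.Properties
open import Data.List.NonEmpty.Base as List⁺ using (_∷_)
open import Data.List.Properties using (++-assoc; ++-identityʳ; ++-ʳ++; ʳ++-defn; ∷-injective; concatMap-++; concatMap-pure; length-++; length-map; length-reverse; map-++; map-cong-local; map-ʳ++; map-∘; mapMaybe-++; reverse-involutive)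
open import Data.List.Relation.Binary.Subset.Propositional using (_⊆_)
open import Data.List.Relation.Unary.All as All using (All; []; _∷_)
import Data.List.Relation.Unary.All.Properties as All
open import Data.List.Relation.Unary.AllPairs using ([]; _∷_)
open import Data.List.Relation.Unary.Any as Any using (here; there)
import Data.List.Relation.Unary.Any.Properties as Any
open import Data.List.Relation.Unary.Unique.DecPropositional.Properties _≟-Name_ using (deduplicate-!)
open import Data.List.Relation.Unary.Unique.Propositional using (Unique)
open import Data.Maybe.Base as Maybe using (Maybe; just; maybe; nothing)
import Data.Maybe.Relation.Unary.Any as MaybeAny
open import Data.Nat.Base using (ℕ; zero; suc; _+_; _*_; _≤_; _≤ᵇ_; s≤s; z≤n)
open import Data.Nat.Properties
open import Data.Nat.Tactic.RingSolver using (solve-∀)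
open import Data.Product using (Σ-syntax; ∃-syntax; _×_; _,_; map₁; proj₁; proj₂; swap)
open import Data.Sum.Base as Sum using (_⊎_; inj₁; inj₂; [_,_]′)
open import Data.Sum.Function.Propositional using (_⊎-↔_)
open import Data.Unit.Base using (⊤; tt)
open import Data.Vec.Base as Vec using (Vec; []; _∷_)
import Data.Vec.Properties as Vec
open import Function.Base using (_∘_; case_of_; const; id)
open import Function.Bundles using (_⇔_; _↔_; mk⇔; mk↔ₛ′; Equivalence)
open import Function.Construct.Composition using (_↔-∘_)
open import Function.Construct.Symmetry using (↔-sym)
import Function.Properties.Equivalence as ⇔
open import Level using (0ℓ)
open import Relation.Binary.PropositionalEquality using (_≡_; _≢_; refl; sym; trans; cong; cong₂; subst; module ≡-Reasoning)
open import Relation.Nullary using (¬_; Dec; yes; no; does)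

open Equivalence using (to; from)

-- An equality-free sentence cannot tell an element from a copy of it, so the
-- reduction gives elements names.  Every element a of a model of the reduction
-- carries two families of bits, its own name and that of a source; "same" stands
-- for equality of names, and "linked a b" entails that a bears the name that b has
-- as its source.  The relations between a source and its target are also stored in
-- unary bits of the target, which may depend only on the two names.  Since every
-- witness is required to be linked, choosing one element for each name gives a model
-- of the original sentence.
--
-- Conversely a satisfiable sentence has a model whose elements can be named by
-- O(n + k) bits.  As in the finite model property of Grädel, Kolaitis and Vardi, it
-- consists of the kings (the elements whose 1-type nobody shares), their witnesses,
-- and one element for each other 1-type, multiplied so that each element can be
-- given its own set of witnesses.
--
-- The reduction itself is a fixed sequence of left-to-right passes over the input,
-- in each of which a name is copied a bounded number of times.

-- Structured programs for Turing machines

-- Two variables cannot say that equally named elements stand in the same relations to a third one,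
-- so the binary relations of a model of the reduction need not respect names. The unary bits of a
-- linked target get around this: that they depend only on its name and its source is a statement
-- about two elements. It is enough to constrain links in this way. A relation between two names
-- matters either as a witness, and witnesses are linked, or as an instance of `α`, which any two
-- bearers of the names satisfy. In the converse direction the difficulty is to name elements with
-- boundedly many bits per symbol. The name of a witness therefore does not record whom it serves,
-- only the symbol it serves for. Two codes might then be each other's witness, with conflicting
-- demands; two phase bits that turn through a cycle of length 4 exclude this. Kings cannot be
-- multiplied, so a king's witness is named instead by the type of the king and the symbol.

module StructuredPrograms (A : Set) where

  Letter : Set
  Letter = A ⊎ ⊥

  Cell : Set
  Cell = Symbol Letter

  infixr 4 _⨾_

  -- basic f m: on scanning a, append f a to the output unless it is blank, then
  -- perform m on the input tape.

  data Program : Set where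
    basic  : (Cell → Cell) → Move → Program
    _⨾_    : Program → Program → Program
    branch : (Cell → Bool) → Program → Program → Program
    while  : (Cell → Bool) → Program → Program

  Point : Program → Set
  Point (basic _ _)    = ⊤
  Point (p ⨾ q)        = Point p ⊎ Point q
  Point (branch _ p q) = ⊤ ⊎ (Point p ⊎ Point q)
  Point (while _ p)    = ⊤ ⊎ Point p

  first : ∀ p → Point p
  first (basic _ _)    = tt
  first (p ⨾ q)        = inj₁ (first p)
  first (branch _ p q) = inj₁ tt
  first (while _ p)    = inj₁ tt

  -- The next control state, nothing meaning that the program is left.

  advance : ∀ p → Point p → Cell → Maybe (Point p) × Cell × Move
  advance (basic f m)    tt              a = nothing , f a , m
  advance (p ⨾ q)        (inj₁ s)        a = map₁ (just ∘ maybe inj₁ (inj₂ (first q))) (advance p s a)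
  advance (p ⨾ q)        (inj₂ s)        a = map₁ (Maybe.map inj₂) (advance q s a)
  advance (branch f p q) (inj₁ tt)       a = just (inj₂ (if f a then inj₁ (first p) else inj₂ (first q))) , nothing , stay
  advance (branch f p q) (inj₂ (inj₁ s)) a = map₁ (Maybe.map (inj₂ ∘ inj₁)) (advance p s a)
  advance (branch f p q) (inj₂ (inj₂ s)) a = map₁ (Maybe.map (inj₂ ∘ inj₂)) (advance q s a)
  advance (while f p)    (inj₁ tt)       a = (if f a then just (inj₂ (first p)) else nothing) , nothing , stay
  advance (while f p)    (inj₂ s)        a = map₁ (just ∘ maybe inj₂ (inj₁ tt)) (advance p s a)

  private
    ⊎-finite : ∀ {B C : Set} → Finite B → Finite C → Finite (B ⊎ C)
    ⊎-finite (m , B↔) (n , C↔) = m + n , ↔-sym +↔⊎ ↔-∘ (B↔ ⊎-↔ C↔)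

    ⊤-finite : Finite ⊤
    ⊤-finite = 1 , ↔-sym 1↔⊤

  Point-finite : ∀ p → Finite (Point p)
  Point-finite (basic _ _)    = ⊤-finite
  Point-finite (p ⨾ q)        = ⊎-finite (Point-finite p) (Point-finite q)
  Point-finite (branch _ p q) = ⊎-finite ⊤-finite (⊎-finite (Point-finite p) (Point-finite q))
  Point-finite (while _ p)    = ⊎-finite ⊤-finite (Point-finite p)

  Maybe-finite : ∀ {B : Set} → Finite B → Finite (Maybe B)
  Maybe-finite B-finite with ⊎-finite ⊤-finite B-finite
  ... | n , ⊤⊎B↔ = n , ⊤⊎B↔ ↔-∘ Maybe↔
    where
    Maybe↔ : ∀ {B : Set} → Maybe B ↔ (⊤ ⊎ B)
    Maybe↔ = mk↔ₛ′ (maybe inj₂ (inj₁ tt)) (λ { (inj₁ tt) → nothing ; (inj₂ b) → just b })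
                   (λ { (inj₁ tt) → refl ; (inj₂ b) → refl }) (λ { nothing → refl ; (just b) → refl })

  -- The output tape is only ever written at its right end.

  outputAction : Cell → Cell → Cell × Move
  outputAction a nothing  = a , stay
  outputAction a (just b) = just b , right

  machine : Program → TuringMachine A
  machine p = record
    { State       = Maybe (Point p)
    ; stateFinite = Maybe-finite (Point-finite p)
    ; Extra       = ⊥
    ; extraFinite = 0 , ↔-sym 0↔⊥
    ; workTapes   = 0
    ; start       = just (first p)
    ; δ           = λ { nothing _ → nothing
                      ; (just s) (a ∷ b ∷ []) → just (instruction s a b) }
    }
    where
    instruction : Point p → Cell → Cell → Maybe (Point p) × Vec (Cell × Move) 2
    instruction s a b with advance p s a
    ... | s′ , c , m = s′ , (a , m) ∷ outputAction b c ∷ []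

  -- The input tape, and the output so far, last letter first.

  Memory : Set
  Memory = Tape Letter × List Letter

  prepend : Cell → List Letter → List Letter
  prepend nothing  o = o
  prepend (just a) o = a ∷ o

  -- Runs p c c′ k: started in c, the program p stops in c′ after at most k steps.

  data Runs : Program → Memory → Memory → ℕ → Set where
    basic   : ∀ {f m t o} → Runs (basic f m) (t , o) (move m t , prepend (f (Tape.head t)) o) 1
    _⨾_     : ∀ {p q c c′ c″ k l} → Runs p c c′ k → Runs q c′ c″ l → Runs (p ⨾ q) c c″ (k + l)
    branch₁ : ∀ {f p q t o c′ k} → f (Tape.head t) ≡ true →
              Runs p (t , o) c′ k → Runs (branch f p q) (t , o) c′ (suc k)
    branch₂ : ∀ {f p q t o c′ k} → f (Tape.head t) ≡ false →
              Runs q (t , o) c′ k → Runs (branch f p q) (t , o) c′ (suc k)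
    while₁  : ∀ {f p t o c′ c″ k l} → f (Tape.head t) ≡ true →
              Runs p (t , o) c′ k → Runs (while f p) c′ c″ l → Runs (while f p) (t , o) c″ (suc (k + l))
    while₂  : ∀ {f p t o} → f (Tape.head t) ≡ false → Runs (while f p) (t , o) (t , o) 1
    weaken  : ∀ {p c c′ k l} → k ≤ l → Runs p c c′ k → Runs p c c′ l

  module Soundness (top : Program) where
    open TuringMachine (machine top) hiding (Letter)

    config : Maybe (Point top) → Memory → Config
    config s (t , o) = s , t ∷ tape (map just o) nothing [] ∷ []

    infix 4 _⇓≤[_]_

    _⇓≤[_]_ : Config → ℕ → Config → Set
    c ⇓≤[ b ] c′ = ∃[ k ] k ≤ b × c ⇓[ k ] c′

    -- The program top contains p at the points ι and leaves it for e.

    Embeds : ∀ p → (Point p → Point top) → Maybe (Point top) → Set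
    Embeds p ι e = ∀ s a → advance top (ι s) a ≡ map₁ (maybe (just ∘ ι) e) (advance p s a)

    private
      next≤ : ∀ {c c′ c″ k} → step c ≡ just c′ → c′ ⇓≤[ k ] c″ → c ⇓≤[ suc k ] c″
      next≤ eq (k , k≤ , r) = suc k , s≤s k≤ , next eq r

      recast : ∀ {c c′ k l} → k ≡ l → c ⇓≤[ k ] c′ → c ⇓≤[ l ] c′
      recast refl r = r

      step-advance : ∀ s {t o s′ c m} → advance top s (Tape.head t) ≡ (s′ , c , m) →
                     step (config (just s) (t , o)) ≡ just (config s′ (move m t , prepend c o))
      step-advance s {t} eq with advance top s (Tape.head t)
      step-advance s {t} {c = nothing} refl | _ = refl
      step-advance s {t} {c = just b}  refl | _ = refl

      fuse-just : ∀ {B C D : Set} {g : C → Maybe D} {e f b} (r : Maybe B × Cell × Move) →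
                  map₁ (maybe g e) (map₁ (just ∘ maybe f b) r) ≡ map₁ (maybe (g ∘ f) (g b)) r
      fuse-just (nothing , _) = refl
      fuse-just (just _ , _)  = refl

      fuse-map : ∀ {B C D : Set} {g : C → Maybe D} {e} {f : B → C} (r : Maybe B × Cell × Move) →
                 map₁ (maybe g e) (map₁ (Maybe.map f) r) ≡ map₁ (maybe (g ∘ f) e) r
      fuse-map (nothing , _) = refl
      fuse-map (just _ , _)  = refl

    -- In continuation form: the rest of the run, from the exit `e` on, is an argument, so each
    -- constructor of `Runs` only puts steps in front, and composing programs is composing
    -- functions.
    sound : ∀ {p ι e c c′ k l z} → Runs p c c′ k → Embeds p ι e →
            config e c′ ⇓≤[ l ] z → config (just (ι (first p))) c ⇓≤[ k + l ] z
    sound {ι = ι} (basic {t = t} {o}) em r = next≤ (step-advance _ {t} {o} (em tt (Tape.head t))) r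
    sound {ι = ι} {e} {l = l} (_⨾_ {p} {q} {k = k} {l = l′} r₁ r₂) em r =
      recast (sym (+-assoc k l′ l))
        (sound r₁ (λ s a → trans (em (inj₁ s) a) (fuse-just {g = just ∘ ι} {e} (advance p s a)))
          (sound r₂ (λ s a → trans (em (inj₂ s) a) (fuse-map (advance q s a))) r))
    sound {ι = ι} (branch₁ {p = p} {t = t} {o} eq r₁) em r =
      next≤ (step-advance _ {t} {o} (trans (em (inj₁ tt) _)
              (cong (λ b → just (ι (inj₂ (if b then _ else _))) , nothing , stay) eq)))
            (sound r₁ (λ s a → trans (em (inj₂ (inj₁ s)) a) (fuse-map (advance p s a))) r)
    sound {ι = ι} (branch₂ {q = q} {t = t} {o} eq r₁) em r =
      next≤ (step-advance _ {t} {o} (trans (em (inj₁ tt) _)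
              (cong (λ b → just (ι (inj₂ (if b then _ else _))) , nothing , stay) eq)))
            (sound r₁ (λ s a → trans (em (inj₂ (inj₂ s)) a) (fuse-map (advance q s a))) r)
    sound {ι = ι} {e} {l = l} (while₁ {p = p} {t = t} {o} {k = k} {l = l′} eq r₁ r₂) em r =
      recast (cong suc (sym (+-assoc k l′ l)))
        (next≤ (step-advance _ {t} {o} (trans (em (inj₁ tt) _)
                 (cong (λ b → maybe (just ∘ ι) e (if b then just (inj₂ (first p)) else nothing) , nothing , stay) eq)))
          (sound r₁ (λ s a → trans (em (inj₂ s) a) (fuse-just {g = just ∘ ι} {e} (advance p s a))) (sound r₂ em r)))
    sound {ι = ι} {e} (while₂ {p = p} {t = t} {o} eq) em r =
      next≤ (step-advance _ {t} {o} (trans (em (inj₁ tt) _)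
              (cong (λ b → maybe (just ∘ ι) e (if b then just (inj₂ (first p)) else nothing) , nothing , stay) eq)))
            r
    sound (weaken k≤ r₁) em r with sound r₁ em r
    ... | n , n≤ , h = n , ≤-trans n≤ (+-monoˡ-≤ _ k≤) , h

  computes : ∀ p {w out t k} → Runs p (load (map inj₁ w) , []) (t , map inj₁ out ʳ++ []) k →
             TuringMachine.Computes_⟼_within_ (machine p) w out k
  computes p {w} {out} {t} {k} r
    with Soundness.sound p r
           (λ { s a → sym (lemma (advance p s a)) }) (0 , z≤n , TuringMachine.halt refl)
    where
    lemma : ∀ {B C : Set} (r : Maybe B × C) → map₁ (maybe just nothing) r ≡ r
    lemma (nothing , _) = refl
    lemma (just _ , _)  = refl
  -- The head ends on the single blank behind the output: `0` blanks precede the word and `1`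
  -- follows it.
  ... | n , n≤ , h = n , _ , _ , ≤-trans n≤ (≤-reflexive (+-identityʳ k)) , h , 0 , 1 , eq
    where
    o = map inj₁ out
    eq : reverse (map just (o ʳ++ [])) ++ nothing ∷ [] ≡ map just o ++ nothing ∷ []
    eq = cong (_++ nothing ∷ []) (begin
      reverse (map just (o ʳ++ [])) ≡⟨ cong reverse (map-ʳ++ just o) ⟩
      reverse (map just o ʳ++ [])   ≡⟨ cong reverse (trans (ʳ++-defn (map just o)) (++-identityʳ _)) ⟩
      reverse (reverse (map just o)) ≡⟨ reverse-involutive (map just o) ⟩
      map just o                    ∎)
      where open ≡-Reasoning

-- The reduction

⋀ : List Formula → Formula
⋀ = foldr _∧ᶠ_ ⊤ᶠ

infixr 5 _⇔ᶠ_

_⇔ᶠ_ : Formula → Formula → Formula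
φ ⇔ᶠ ψ = (φ ⇒ᶠ ψ) ∧ᶠ (ψ ⇒ᶠ φ)

symbol : Atom → Maybe Name
symbol (unary U _)    = just U
symbol (binary R _ _) = just R
symbol (equal _ _)    = nothing

symbols : Formula → List Name
symbols φ = mapMaybe symbol (atoms φ)

renameAtom : (Name → Name) → Atom → Atom
renameAtom f (unary U v)    = unary (f U) v
renameAtom f (binary R u v) = binary (f R) u v
renameAtom f (equal u v)    = equal u v

rename : (Name → Name) → Formula → Formula
rename f (atom a)  = atom (renameAtom f a)
rename f ⊤ᶠ        = ⊤ᶠ
rename f ⊥ᶠ        = ⊥ᶠ
rename f (¬ᶠ φ)    = ¬ᶠ rename f φ
rename f (φ ∧ᶠ ψ)  = rename f φ ∧ᶠ rename f ψ
rename f (φ ∨ᶠ ψ)  = rename f φ ∨ᶠ rename f ψ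
rename f (φ ⇒ᶠ ψ)  = rename f φ ⇒ᶠ rename f ψ
rename f (∀ᶠ v φ)  = ∀ᶠ v (rename f φ)
rename f (∃ᶠ v φ)  = ∃ᶠ v (rename f φ)

-- θ is a formula about tags; the tags are completed by each symbol in turn.

forEach : Formula → List Name → Formula
forEach θ ws = ⋀ (map (λ w → rename (_++ w) θ) ws)

-- The own bit 0 of a unary symbol is its interpretation.

ownTag sourceTag : ℕ → Name
ownTag    i = true ∷ replicate i true ∷ʳ false
sourceTag i = false ∷ true ∷ replicate i true ∷ʳ false

-- Own tags begin with 1, source tags with 01 and the pair tag is 00; with the closing zero after
-- the ones, no unary tag is a prefix of another, so the appended symbol can be recovered. The
-- relation tag keeps clear of the binary names `[]` and `false ∷ []`.
pairTag relationTag : Name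
pairTag     = false ∷ false ∷ []
relationTag = true ∷ []

sameᶠ linkedᶠ : Var → Var → Formula
sameᶠ u v   = atom (binary [] u v)
linkedᶠ u v = atom (binary (false ∷ []) u v)

translateAtom : Atom → Atom
translateAtom (unary U v)    = unary (ownTag 0 ++ U) v
translateAtom (binary R u v) = binary (relationTag ++ R) u v
translateAtom (equal u v)    = binary [] u v

-- Only ∃ᶠ y matters; binding y in every case makes the translation act on single
-- tokens.

translate : Formula → Formula
translate (atom a)  = atom (translateAtom a)
translate ⊤ᶠ        = ⊤ᶠ
translate ⊥ᶠ        = ⊥ᶠ
translate (¬ᶠ φ)    = ¬ᶠ translate φ
translate (φ ∧ᶠ ψ)  = translate φ ∧ᶠ translate ψ
translate (φ ∨ᶠ ψ)  = translate φ ∨ᶠ translate ψ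
translate (φ ⇒ᶠ ψ)  = translate φ ⇒ᶠ translate ψ
translate (∀ᶠ v φ)  = ∀ᶠ v (translate φ)
translate (∃ᶠ v φ)  = ∃ᶠ y (linkedᶠ x v ∧ᶠ translate φ)

-- The shape of the output is separated from the input, so that it can be compiled once into a
-- program that does not depend on the input.
data Schema : Set where
  fixed      : Formula → Schema
  translated : Schema
  each       : Formula → Schema
  _∧ˢ_ _⇒ˢ_  : Schema → Schema → Schema
  ∀ˢ         : Var → Schema → Schema

infixr 7 _∧ˢ_
infixr 5 _⇒ˢ_

instantiate : Schema → Formula → Formula
instantiate (fixed ψ)  φ = ψ
instantiate translated φ = translate φ
instantiate (each θ)   φ = forEach θ (symbols φ)
instantiate (s ∧ˢ s′)  φ = instantiate s φ ∧ᶠ instantiate s′ φ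
instantiate (s ⇒ˢ s′)  φ = instantiate s φ ⇒ᶠ instantiate s′ φ
instantiate (∀ˢ v s)   φ = ∀ᶠ v (instantiate s φ)

-- Encodings

translateToken : Token → List Token
translateToken unary  = unary ∷ map bit (ownTag 0)
translateToken binary = binary ∷ map bit relationTag
translateToken equal  = binary ∷ end ∷ []
-- The guard lacks its second argument: the `var v` that follows `exists` in the input is copied
-- unchanged and supplies it.
translateToken exists = exists ∷ var y ∷ conj ∷ binary ∷ bit false ∷ end ∷ var x ∷ []
translateToken t      = t ∷ []

private
  encodeName-untouched : ∀ {h : Token → List Token} → (∀ b → h (bit b) ≡ bit b ∷ []) → h end ≡ end ∷ [] →
                         ∀ w ts → concatMap h (encodeName w ++ ts) ≡ encodeName w ++ concatMap h ts
  encodeName-untouched hb he []      ts rewrite he = refl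
  encodeName-untouched hb he (b ∷ w) ts rewrite hb b = cong (bit b ∷_) (encodeName-untouched hb he w ts)

encode-translate : ∀ φ → encode (translate φ) ≡ concatMap translateToken (encode φ)
encode-translate (atom (unary U v)) =
  cong (λ ts → unary ∷ bit true ∷ bit false ∷ ts) (sym (encodeName-untouched (λ _ → refl) refl U _))
encode-translate (atom (binary R u v)) =
  cong (λ ts → binary ∷ bit true ∷ ts) (sym (encodeName-untouched (λ _ → refl) refl R _))
encode-translate (atom (equal u v)) = refl
encode-translate ⊤ᶠ       = refl
encode-translate ⊥ᶠ       = refl
encode-translate (¬ᶠ φ)   = cong (neg ∷_) (encode-translate φ)
encode-translate (φ ∧ᶠ ψ) = cong (conj ∷_)
  (trans (cong₂ _++_ (encode-translate φ) (encode-translate ψ)) (sym (concatMap-++ _ (encode φ) _)))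
encode-translate (φ ∨ᶠ ψ) = cong (disj ∷_)
  (trans (cong₂ _++_ (encode-translate φ) (encode-translate ψ)) (sym (concatMap-++ _ (encode φ) _)))
encode-translate (φ ⇒ᶠ ψ) = cong (imp ∷_)
  (trans (cong₂ _++_ (encode-translate φ) (encode-translate ψ)) (sym (concatMap-++ _ (encode φ) _)))
encode-translate (∀ᶠ v φ) = cong (λ ts → forAll ∷ var v ∷ ts) (encode-translate φ)
encode-translate (∃ᶠ v φ) = cong (λ ts → exists ∷ var y ∷ conj ∷ binary ∷ bit false ∷ end ∷ var x ∷ var v ∷ ts) (encode-translate φ)

-- The end of a tag is where the symbol is to be appended.

completeToken : Name → Token → List Token
completeToken w end = encodeName w
completeToken w t   = t ∷ []

encode-complete : ∀ w φ → encode (rename (_++ w) φ) ≡ concatMap (completeToken w) (encode φ)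
encode-complete w (atom a) = encodeAtom-complete a
  where
  encodeName-complete : ∀ U ts → encodeName (U ++ w) ++ concatMap (completeToken w) ts ≡
                        concatMap (completeToken w) (encodeName U ++ ts)
  encodeName-complete []      ts = refl
  encodeName-complete (b ∷ U) ts = cong (bit b ∷_) (encodeName-complete U ts)

  encodeAtom-complete : ∀ a → encodeAtom (renameAtom (_++ w) a) ≡ concatMap (completeToken w) (encodeAtom a)
  encodeAtom-complete (unary U v)    = cong (unary ∷_) (encodeName-complete U _)
  encodeAtom-complete (binary R u v) = cong (binary ∷_) (encodeName-complete R _)
  encodeAtom-complete (equal u v)    = refl
encode-complete w ⊤ᶠ       = refl
encode-complete w ⊥ᶠ       = refl
encode-complete w (¬ᶠ φ)   = cong (neg ∷_) (encode-complete w φ)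
encode-complete w (φ ∧ᶠ ψ) = cong (conj ∷_)
  (trans (cong₂ _++_ (encode-complete w φ) (encode-complete w ψ)) (sym (concatMap-++ _ (encode φ) _)))
encode-complete w (φ ∨ᶠ ψ) = cong (disj ∷_)
  (trans (cong₂ _++_ (encode-complete w φ) (encode-complete w ψ)) (sym (concatMap-++ _ (encode φ) _)))
encode-complete w (φ ⇒ᶠ ψ) = cong (imp ∷_)
  (trans (cong₂ _++_ (encode-complete w φ) (encode-complete w ψ)) (sym (concatMap-++ _ (encode φ) _)))
encode-complete w (∀ᶠ v φ) = cong (λ ts → forAll ∷ var v ∷ ts) (encode-complete w φ)
encode-complete w (∃ᶠ v φ) = cong (λ ts → exists ∷ var v ∷ ts) (encode-complete w φ)

conjunct : List Token → Name → List Token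
conjunct ts w = conj ∷ concatMap (completeToken w) ts

encode-forEach : ∀ θ ws → encode (forEach θ ws) ≡ concatMap (conjunct (encode θ)) ws ++ true ∷ []
encode-forEach θ []       = refl
encode-forEach θ (w ∷ ws) = cong (conj ∷_) (trans
  (cong₂ _++_ (encode-complete w θ) (encode-forEach θ ws))
  (sym (++-assoc (concatMap (completeToken w) (encode θ)) _ _)))

-- Passes over the input

open StructuredPrograms Token

⌜_⌝ : List Token → List Letter
⌜_⌝ = map inj₁

cells : List Token → List Cell
cells = map (just ∘ inj₁)

-- The tape whose cells left of the head are L, read leftwards, and whose other
-- cells are R.

at : List Cell → List Cell → Tape Letter
at L []      = tape L nothing []
at L (s ∷ R) = tape L s R

go : Move → Program
go = basic (const nothing)

emit : Token → Program
emit t = basic (const (just (inj₁ t))) stay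

basic-right : ∀ {f L s R o} → Runs (basic f right) (at L (s ∷ R) , o) (at (s ∷ L) R , prepend (f s) o) 1
basic-right {R = []}    = basic
basic-right {R = _ ∷ _} = basic

cast : ∀ {p t t′ u u′ o q q′ k l} → t ≡ t′ → u ≡ u′ → q ≡ q′ → k ≡ l →
       Runs p (t , o) (u , q) k → Runs p (t′ , o) (u′ , q′) l
cast refl refl refl refl r = r

-- A step writes at most one letter, so `n` has to bound the words for all scanned letters at once;
-- a shorter word leaves the remaining steps without output.
emitAll : ℕ → (Cell → List Letter) → Program
emitAll zero    f = go stay
emitAll (suc n) f = basic (head ∘ f) stay ⨾ emitAll n (drop 1 ∘ f)

emitAll-runs : ∀ n f {t o} → length (f (Tape.head t)) ≤ n →
               Runs (emitAll n f) (t , o) (t , f (Tape.head t) ʳ++ o) (suc n)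
emitAll-runs zero f {t} len≤ with f (Tape.head t)
emitAll-runs zero f {t} z≤n | [] = basic
emitAll-runs (suc n) f {t} {o} len≤ =
  cast refl refl (emitted (f a)) refl (basic ⨾ emitAll-runs n (drop 1 ∘ f) (shorter (f a) len≤))
  where
  a = Tape.head t
  emitted : ∀ os → drop 1 os ʳ++ prepend (head os) o ≡ os ʳ++ o
  emitted []       = refl
  emitted (_ ∷ os) = refl
  shorter : ∀ (os : List Letter) → length os ≤ suc n → length (drop 1 os) ≤ n
  shorter []       _         = z≤n
  shorter (_ ∷ os) (s≤s len) = len

private
  ⌜⌝-++-ʳ++ : ∀ u v {o} → ⌜ v ⌝ ʳ++ (⌜ u ⌝ ʳ++ o) ≡ ⌜ u ++ v ⌝ ʳ++ o
  ⌜⌝-++-ʳ++ u v = trans (sym (++-ʳ++ ⌜ u ⌝)) (cong (_ʳ++ _) (sym (map-++ inj₁ u v)))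

  cells-++-ʳ++ : ∀ u v {L} → cells v ʳ++ (cells u ʳ++ L) ≡ cells (u ++ v) ʳ++ L
  cells-++-ʳ++ u v = trans (sym (++-ʳ++ (cells u))) (cong (_ʳ++ _) (sym (map-++ _ u v)))

  cells-++-++ : ∀ u v {R} → cells u ++ (cells v ++ R) ≡ cells (u ++ v) ++ R
  cells-++-++ u v = trans (sym (++-assoc (cells u) _ _)) (cong (_++ _) (sym (map-++ _ u v)))

Reads : (Cell → Bool) → Program → ℕ → (Token → List Token) → Token → Set
Reads f p k out t =
  f (just (inj₁ t)) ≡ true ×
  (∀ {L R o} → Runs p (at L (just (inj₁ t) ∷ R) , o) (at (just (inj₁ t) ∷ L) R , ⌜ out t ⌝ ʳ++ o) k)

scan : ∀ {f p k} out w {L R o} → All (Reads f p k out) w → (∀ {L} → f (Tape.head (at L R)) ≡ false) →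
       Runs (while f p) (at L (cells w ++ R) , o) (at (cells w ʳ++ L) R , ⌜ concatMap out w ⌝ ʳ++ o) (length w * suc k + 1)
scan out []      []                  stop = while₂ stop
scan {k = k} out (t ∷ w) {o = o} ((ft , body) ∷ bodies) stop =
  cast refl refl (⌜⌝-++-ʳ++ (out t) (concatMap out w)) (cong suc (sym (+-assoc k _ 1)))
    (while₁ ft body (scan out w bodies stop))

-- The initial `go left` skips the cell where the scan begins, an `end` or a blank in the uses
-- below, on which the test fails already.
scanLeft : (Cell → Bool) → Program
scanLeft f = go left ⨾ while f (go left)

scanLeft-runs : ∀ {f} r {z L s R o} → All (λ a → f a ≡ true) r → f z ≡ false →
                Runs (scanLeft f) (at (r ++ z ∷ L) (s ∷ R) , o) (at L (z ∷ (r ʳ++ s ∷ R)) , o) (suc (suc (length r * 2)))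
scanLeft-runs {f} r {z} {L} {o = o} = λ fr fz → start r fr fz
  where
  loop : ∀ r {a R} → f a ≡ true → All (λ a → f a ≡ true) r → f z ≡ false →
         Runs (while f (go left)) (at (r ++ z ∷ L) (a ∷ R) , o) (at L (z ∷ (r ʳ++ a ∷ R)) , o) (suc (suc (length r) * 2))
  loop []      fa []        fz = while₁ fa basic (while₂ fz)
  loop (b ∷ r) fa (fb ∷ fr) fz = while₁ fa basic (loop r fb fr fz)
  start : ∀ r {s R} → All (λ a → f a ≡ true) r → f z ≡ false →
          Runs (scanLeft f) (at (r ++ z ∷ L) (s ∷ R) , o) (at L (z ∷ (r ʳ++ s ∷ R)) , o) (suc (suc (length r * 2)))
  start []      []        fz = basic ⨾ while₂ fz
  start (b ∷ r) (fb ∷ fr) fz = basic ⨾ loop r fb fr fz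

back : (Cell → Bool) → Program
back f = scanLeft f ⨾ go right

back-runs : ∀ {f} u {z L s R o} → All (λ a → f a ≡ true) u → f z ≡ false →
            Runs (back f) (at (u ʳ++ z ∷ L) (s ∷ R) , o) (at (z ∷ L) (u ++ s ∷ R) , o) (length u * 2 + 3)
back-runs {f} u {z} {L} {s} {R} {o} fu fz =
  cast (cong (λ L′ → at L′ (s ∷ R)) (sym (ʳ++-defn u))) (cong (at (z ∷ L)) restored) refl
       (trans (cong (λ n → suc (suc (n * 2)) + 1) (length-reverse u)) (cost (length u)))
    (scanLeft-runs (reverse u) (All.tabulate (All.lookup fu ∘ Any.reverse⁻)) fz ⨾ basic-right)
  where
  restored : reverse u ʳ++ s ∷ R ≡ u ++ s ∷ R
  restored = trans (ʳ++-defn (reverse u)) (cong (_++ s ∷ R) (reverse-involutive u))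
  cost : ∀ n → suc (suc (n * 2)) + 1 ≡ n * 2 + 3
  cost = solve-∀

nonblank : Cell → Bool
nonblank nothing  = false
nonblank (just _) = true

isBit : Cell → Bool
isBit (just (inj₁ (bit _))) = true
isBit _                     = false

isSymbol : Cell → Bool
isSymbol (just (inj₁ unary))  = true
isSymbol (just (inj₁ binary)) = true
isSymbol _                    = false

-- Between passes the head is on the first letter of the input word, which has a
-- recorded blank on either side.

rewound : List Token → Tape Letter
rewound w = at [ nothing ] (cells w ++ [ nothing ])

private
  all-nonblank : ∀ w → All (λ a → nonblank a ≡ true) (cells w)
  all-nonblank []      = []
  all-nonblank (_ ∷ w) = refl ∷ all-nonblank w

rewind-runs : ∀ w {o} → Runs (back nonblank) (at (cells w ʳ++ [ nothing ]) [ nothing ] , o) (rewound w , o) (length w * 2 + 3)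
rewind-runs w = cast refl refl refl (cong (λ n → n * 2 + 3) (length-map _ w)) (back-runs (cells w) (all-nonblank w) refl)

-- The first pass only records the blanks.

prepare : Program
prepare = go left ⨾ go right ⨾ while nonblank (go right) ⨾ back nonblank

prepare-runs : ∀ t w → Runs prepare (load ⌜ t ∷ w ⌝ , []) (rewound (t ∷ w) , []) (length (t ∷ w) * 4 + 6)
prepare-runs t w =
  cast refl refl nothing-emitted (cost (length (t ∷ w)))
    (basic ⨾ basic-right ⨾
      cast (cong (λ R → at [ nothing ] (just (inj₁ t) ∷ R)) (trans (++-identityʳ _) map-just-inj₁)) refl refl refl
        (scan {p = go right} (const []) (t ∷ w) (All.universal (λ _ → refl , λ {_} {_} {_} → basic-right) _) refl)
      ⨾ rewind-runs (t ∷ w))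
  where
  nothing-emitted : ⌜ concatMap (const []) (t ∷ w) ⌝ ʳ++ [] ≡ []
  nothing-emitted = nothing-emitted′ w
    where
    nothing-emitted′ : ∀ w → ⌜ concatMap (const []) w ⌝ ʳ++ [] ≡ []
    nothing-emitted′ []      = refl
    nothing-emitted′ (_ ∷ w) = nothing-emitted′ w
  map-just-inj₁ : cells w ≡ map just ⌜ w ⌝
  map-just-inj₁ = map-∘ w
  cost : ∀ n → 1 + (1 + ((n * 2 + 1) + (n * 2 + 3))) ≡ n * 4 + 6
  cost = solve-∀

translateCell : Cell → List Letter
translateCell (just (inj₁ t)) = ⌜ translateToken t ⌝
translateCell _               = []

-- `7` is the length of the longest image of a token, that of `exists`.
translation : Program
translation = while nonblank (emitAll 7 translateCell ⨾ go right) ⨾ back nonblank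

translation-runs : ∀ w {o} → Runs translation (rewound w , o) (rewound w , ⌜ concatMap translateToken w ⌝ ʳ++ o) (length w * 12 + 4)
translation-runs w =
  cast refl refl refl (cost (length w))
    (scan translateToken w (All.universal (λ t → refl , λ {_} {_} {_} → (emitAll-runs 7 translateCell (short t) ⨾ basic-right)) w) refl
     ⨾ rewind-runs w)
  where
  short : ∀ t → length ⌜ translateToken t ⌝ ≤ 7
  short t = ≤ᵇ⇒≤ (length ⌜ translateToken t ⌝) 7 (check t)
    where
    check : ∀ t → T (length ⌜ translateToken t ⌝ ≤ᵇ 7)
    check (var _) = tt
    check unary   = tt
    check binary  = tt
    check equal   = tt
    check (bit _) = tt
    check end     = tt
    check true    = tt
    check false   = tt
    check neg     = tt
    check conj    = tt
    check disj    = tt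
    check imp     = tt
    check forAll  = tt
    check exists  = tt
  cost : ∀ n → (n * 10 + 1) + (n * 2 + 3) ≡ n * 12 + 4
  cost = solve-∀

-- With the head behind a symbol token, append the name that follows it, and
-- return.

paste : Program
paste = while isBit (basic id right) ⨾ emit end ⨾ back isBit

paste-runs : ∀ w {s L R o} → isBit s ≡ false →
             Runs paste (at (s ∷ L) (cells (encodeName w) ++ R) , o)
                        (at (s ∷ L) (cells (encodeName w) ++ R) , ⌜ encodeName w ⌝ ʳ++ o)
                        (length (encodeName w) * 5)
paste-runs w {s} {L} {R} {o} not-bit =
  weaken cost
    (cast (cong (at (s ∷ L)) split) (cong (at (s ∷ L)) split) written refl
      (scan [_] (map bit w) (bits-read w) refl ⨾ basic ⨾ back-runs (cells (map bit w)) (all-bits w) not-bit))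
  where
  split : cells (map bit w) ++ just (inj₁ end) ∷ R ≡ cells (encodeName w) ++ R
  split = cells-++-++ (map bit w) [ end ]
  all-bits : ∀ w → All (λ a → isBit a ≡ true) (cells (map bit w))
  all-bits []      = []
  all-bits (_ ∷ w) = refl ∷ all-bits w
  bits-read : ∀ w → All (Reads isBit (basic id right) 1 [_]) (map bit w)
  bits-read []      = []
  bits-read (_ ∷ w) = (refl , λ {_} {_} {_} → basic-right) ∷ bits-read w
  written : inj₁ end ∷ (⌜ concatMap [_] (map bit w) ⌝ ʳ++ o) ≡ ⌜ encodeName w ⌝ ʳ++ o
  written = trans (cong (λ ts → inj₁ end ∷ (⌜ ts ⌝ ʳ++ o)) (concatMap-pure (map bit w))) (⌜⌝-++-ʳ++ (map bit w) [ end ])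
  cost : (length (map bit w) * 2 + 1) + (1 + (length (cells (map bit w)) * 2 + 3)) ≤ length (encodeName w) * 5
  cost rewrite length-++ (map bit w) {[ end ]} | length-map {B = Cell} (just ∘ inj₁) (map bit w) =
    ≤-trans (m≤m+n _ (length (map bit w))) (≤-reflexive (arith (length (map bit w))))
    where
    arith : ∀ n → (n * 2 + 1) + (1 + (n * 2 + 3)) + n ≡ (n + 1) * 5
    arith = solve-∀

completion : List Token → Program
completion []         = go stay
completion (end ∷ ts) = paste ⨾ completion ts
completion (t ∷ ts)   = emit t ⨾ completion ts

completion-runs : ∀ ts w {s L R o} → isBit s ≡ false →
                  Runs (completion ts) (at (s ∷ L) (cells (encodeName w) ++ R) , o)
                       (at (s ∷ L) (cells (encodeName w) ++ R) , ⌜ concatMap (completeToken w) ts ⌝ ʳ++ o)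
                       (length ts * (length (encodeName w) * 5) + 1)
completion-runs []       w not-bit = basic
completion-runs (t ∷ ts) w {s} {L} {R} {o} not-bit = token t
  where
  n = length (encodeName w) * 5

  1≤n : 1 ≤ n
  1≤n with map bit w
  ... | []    = s≤s z≤n
  ... | _ ∷ _ = s≤s z≤n

  rest : ∀ {o} → Runs (completion ts) _ (_ , ⌜ concatMap (completeToken w) ts ⌝ ʳ++ o) (length ts * n + 1)
  rest = completion-runs ts w {s} {L} {R} not-bit

  letter : ∀ t → Runs (emit t ⨾ completion ts) (at (s ∷ L) (cells (encodeName w) ++ R) , o)
                      (_ , ⌜ t ∷ concatMap (completeToken w) ts ⌝ ʳ++ o) (suc (length ts) * n + 1)
  letter t = weaken (≤-trans (+-monoˡ-≤ _ 1≤n) (≤-reflexive (sym (+-assoc n _ 1)))) (basic ⨾ rest)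

  token : ∀ t → Runs (completion (t ∷ ts)) (at (s ∷ L) (cells (encodeName w) ++ R) , o)
                     (_ , ⌜ concatMap (completeToken w) (t ∷ ts) ⌝ ʳ++ o) (suc (length ts) * n + 1)
  token end     = cast refl refl (⌜⌝-++-ʳ++ (encodeName w) _) (sym (+-assoc n _ 1)) (paste-runs w not-bit ⨾ rest)
  token (var v) = letter (var v)
  token unary   = letter unary
  token binary  = letter binary
  token equal   = letter equal
  token (bit b) = letter (bit b)
  token true    = letter true
  token false   = letter false
  token neg     = letter neg
  token conj    = letter conj
  token disj    = letter disj
  token imp     = letter imp
  token forAll  = letter forAll
  token exists  = letter exists

-- The pass that completes a formula by every symbol of the input

module SymbolPass (ts : List Token) where

  body loop pass : Program
  body = branch isSymbol (go right ⨾ emit conj ⨾ completion ts) (go right)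
  loop = while nonblank body
  pass = loop ⨾ emit true ⨾ back nonblank

  -- A cost per letter of the input. For a letter of a symbol's name, 5 steps per token of `ts` pay
  -- for pasting and 3 for moving across; the other 5 cover the two tests, the move, the `conj` and
  -- the end of `completion` at a symbol token.
  C : ℕ
  C = length ts * 5 + 8

  -- The loop moves over u and treats the symbols ws on the way, at cost n; k and c
  -- stand for the rest of its run.

  record Crosses (u : List Token) (ws : List Name) (n : ℕ) : Set where
    constructor crossing
    field
      cross : ∀ {L R o c k} → Runs loop (at (cells u ʳ++ L) R , ⌜ concatMap (conjunct ts) ws ⌝ ʳ++ o) c k →
              Runs loop (at L (cells u ++ R) , o) c (n + k)

  open Crosses

  crosses-[] : Crosses [] [] 0
  crosses-[] = crossing id

  crosses-++ : ∀ {u v us vs m n} → Crosses u us m → Crosses v vs n → Crosses (u ++ v) (us ++ vs) (m + n)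
  crosses-++ {u} {v} {us} {vs} {m} {n} cu cv = crossing λ {L} {R} {o} {c} {k} r →
    cast (cong (at L) (cells-++-++ u v)) refl refl (sym (+-assoc m n k))
      (cross cu (cross cv (cast (cong (λ L → at L R) (sym (cells-++-ʳ++ u v))) refl refl refl
        (subst (λ o → Runs loop (_ , o) c k) split r))))
    where
    split : ∀ {o} → ⌜ concatMap (conjunct ts) (us ++ vs) ⌝ ʳ++ o ≡
                    ⌜ concatMap (conjunct ts) vs ⌝ ʳ++ (⌜ concatMap (conjunct ts) us ⌝ ʳ++ o)
    split {o} = trans (cong (λ ts → ⌜ ts ⌝ ʳ++ o) (concatMap-++ (conjunct ts) us vs))
                      (sym (⌜⌝-++-ʳ++ (concatMap (conjunct ts) us) _))

  crosses-plain : ∀ {t} → isSymbol (just (inj₁ t)) ≡ false → Crosses [ t ] [] 3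
  crosses-plain plain = crossing (while₁ refl (branch₂ plain basic-right))

  crosses-weaken : ∀ {u ws m n} → m ≤ n → Crosses u ws m → Crosses u ws n
  crosses-weaken m≤n cu = crossing λ {_} {_} {_} {_} {k} r → weaken (+-monoˡ-≤ k m≤n) (cross cu r)

  crosses-name : ∀ w → Crosses (encodeName w) [] (length (encodeName w) * 3)
  crosses-name []      = crosses-plain refl
  crosses-name (b ∷ w) = crosses-++ {u = [ bit b ]} {us = []} (crosses-plain refl) (crosses-name w)

  crosses-vars : ∀ vs → Crosses (map var vs) [] (length (map var vs) * 3)
  crosses-vars []       = crosses-[]
  crosses-vars (v ∷ vs) = crosses-++ {u = [ var v ]} {us = []} (crosses-plain refl) (crosses-vars vs)

  -- The loop body returns the head to just behind the symbol token, so the name is crossed a second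
  -- time, now as plain letters.
  crosses-symbol : ∀ {t} w vs → isSymbol (just (inj₁ t)) ≡ true → isBit (just (inj₁ t)) ≡ false →
                   Crosses (t ∷ encodeName w ++ map var vs) [ w ] (length (t ∷ encodeName w ++ map var vs) * C)
  crosses-symbol {t} w vs symb not-bit = crossing λ {L} {R} {o} {c} {k} r →
    weaken (cost k)
      (while₁ refl (branch₁ symb (basic-right ⨾ basic ⨾ completed))
        (cross (crosses-++ (crosses-name w) (crosses-vars vs))
          (subst (λ o → Runs loop (at (cells (t ∷ e ++ map var vs) ʳ++ L) R , o) c k) written r)))
    where
    e = encodeName w
    split : ∀ {R} → cells e ++ (cells (map var vs) ++ R) ≡ cells (e ++ map var vs) ++ R
    split = cells-++-++ e (map var vs)
    completed : ∀ {L R o} → Runs (completion ts) (at (just (inj₁ t) ∷ L) (cells (e ++ map var vs) ++ R) , o)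
                              (at (just (inj₁ t) ∷ L) (cells (e ++ map var vs) ++ R) , ⌜ concatMap (completeToken w) ts ⌝ ʳ++ o)
                              (length ts * (length e * 5) + 1)
    completed = cast (cong (at _) split) (cong (at _) split) refl refl (completion-runs ts w not-bit)
    written : ∀ {o} → ⌜ concatMap (conjunct ts) [ w ] ⌝ ʳ++ o ≡ ⌜ concatMap (completeToken w) ts ⌝ ʳ++ (inj₁ conj ∷ o)
    written {o} = cong (λ ts → ⌜ ts ⌝ ʳ++ (inj₁ conj ∷ o)) (++-identityʳ (concatMap (completeToken w) ts))
    arith : ∀ p q n k → suc (suc (1 + (1 + (p * (q * 5) + 1))) + ((q * 3 + n * 3) + k)) + ((q + n + p + p * n) * 5 + 3)
                        ≡ suc (q + n) * (p * 5 + 8) + k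
    arith = solve-∀
    cost : ∀ k → suc (suc (1 + (1 + (length ts * (length e * 5) + 1))) + ((length e * 3 + length (map var vs) * 3) + k))
           ≤ length (t ∷ e ++ map var vs) * C + k
    cost k rewrite length-++ e {map var vs} =
      ≤-trans (m≤m+n _ _) (≤-reflexive (arith (length ts) (length e) (length (map var vs)) k))

  private
    3≤C : 3 ≤ C
    3≤C = ≤-trans (s≤s (s≤s (s≤s z≤n))) (m≤n+m 8 (length ts * 5))

  crosses-∷ : ∀ {t u ws} → isSymbol (just (inj₁ t)) ≡ false → Crosses u ws (length u * C) →
              Crosses (t ∷ u) ws (length (t ∷ u) * C)
  crosses-∷ plain = crosses-++ {us = []} (crosses-weaken 3≤C (crosses-plain plain))

  crosses-formulas : ∀ φ ψ → Crosses (encode φ) (symbols φ) (length (encode φ) * C) →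
                     Crosses (encode ψ) (symbols ψ) (length (encode ψ) * C) →
                     Crosses (encode φ ++ encode ψ) (mapMaybe symbol (atoms φ ++ atoms ψ)) (length (encode φ ++ encode ψ) * C)
  crosses-formulas φ ψ cφ cψ
    rewrite length-++ (encode φ) {encode ψ} | mapMaybe-++ symbol (atoms φ) (atoms ψ)
          | *-distribʳ-+ C (length (encode φ)) (length (encode ψ))
    = crosses-++ {u = encode φ} {us = symbols φ} cφ cψ

  crosses-formula : ∀ φ → Crosses (encode φ) (symbols φ) (length (encode φ) * C)
  crosses-formula (atom (unary U v))    = crosses-symbol U (v ∷ []) refl refl
  crosses-formula (atom (binary R u v)) = crosses-symbol R (u ∷ v ∷ []) refl refl
  crosses-formula (atom (equal u v))    =
    crosses-∷ {equal} refl (crosses-∷ {var u} refl (crosses-∷ {var v} refl crosses-[]))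
  crosses-formula ⊤ᶠ       = crosses-∷ {true} refl crosses-[]
  crosses-formula ⊥ᶠ       = crosses-∷ {false} refl crosses-[]
  crosses-formula (¬ᶠ φ)   = crosses-∷ {neg} refl (crosses-formula φ)
  crosses-formula (φ ∧ᶠ ψ) = crosses-∷ {conj} refl (crosses-formulas φ ψ (crosses-formula φ) (crosses-formula ψ))
  crosses-formula (φ ∨ᶠ ψ) = crosses-∷ {disj} refl (crosses-formulas φ ψ (crosses-formula φ) (crosses-formula ψ))
  crosses-formula (φ ⇒ᶠ ψ) = crosses-∷ {imp} refl (crosses-formulas φ ψ (crosses-formula φ) (crosses-formula ψ))
  crosses-formula (∀ᶠ v φ) = crosses-∷ {forAll} refl (crosses-∷ {var v} refl (crosses-formula φ))
  crosses-formula (∃ᶠ v φ) = crosses-∷ {exists} refl (crosses-∷ {var v} refl (crosses-formula φ))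

  pass-runs : ∀ φ {o} → Runs pass (rewound (encode φ) , o)
                (rewound (encode φ) , ⌜ concatMap (conjunct ts) (symbols φ) ++ [ true ] ⌝ ʳ++ o)
                (length (encode φ) * (C + 2) + 5)
  pass-runs φ {o} =
    cast refl refl (⌜⌝-++-ʳ++ (concatMap (conjunct ts) (symbols φ)) [ true ]) (arith (length (encode φ)) C)
      (cross (crosses-formula φ) (while₂ refl) ⨾ basic ⨾ rewind-runs (encode φ))
    where
    arith : ∀ n c → (n * c + 1) + (1 + (n * 2 + 3)) ≡ n * (c + 2) + 5
    arith = solve-∀

-- Compilation of schemas into programs

emitAll-tokens : List Token → Program
emitAll-tokens ts = emitAll (length ⌜ ts ⌝) (const ⌜ ts ⌝)

compile : Schema → Program
compile (fixed ψ)  = emitAll-tokens (encode ψ)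
compile translated = translation
compile (each θ)   = SymbolPass.pass (encode θ)
compile (s ∧ˢ s′)  = emit conj ⨾ compile s ⨾ compile s′
compile (s ⇒ˢ s′)  = emit imp ⨾ compile s ⨾ compile s′
compile (∀ˢ v s)   = emit forAll ⨾ emit (var v) ⨾ compile s

factor offset : Schema → ℕ
factor (fixed ψ)  = 0
factor translated = 12
factor (each θ)   = length (encode θ) * 5 + 8 + 2
factor (s ∧ˢ s′)  = factor s + factor s′
factor (s ⇒ˢ s′)  = factor s + factor s′
factor (∀ˢ v s)   = factor s
offset (fixed ψ)  = suc (length ⌜ encode ψ ⌝)
offset translated = 4
offset (each θ)   = 5
offset (s ∧ˢ s′)  = 1 + (offset s + offset s′)
offset (s ⇒ˢ s′)  = 1 + (offset s + offset s′)
offset (∀ˢ v s)   = 2 + offset s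

compile-runs : ∀ s φ {o} → Runs (compile s) (rewound (encode φ) , o)
                 (rewound (encode φ) , ⌜ encode (instantiate s φ) ⌝ ʳ++ o)
                 (length (encode φ) * factor s + offset s)
compile-runs (fixed ψ)  φ = weaken (m≤n+m _ _) (emitAll-runs (length ⌜ encode ψ ⌝) (const ⌜ encode ψ ⌝) ≤-refl)
compile-runs translated φ {o} =
  cast refl refl (cong (λ ts → ⌜ ts ⌝ ʳ++ o) (sym (encode-translate φ))) refl (translation-runs (encode φ))
compile-runs (each θ)   φ {o} =
  cast refl refl (cong (λ ts → ⌜ ts ⌝ ʳ++ o) (sym (encode-forEach θ (symbols φ)))) refl (SymbolPass.pass-runs (encode θ) φ)
compile-runs (s ∧ˢ s′)  φ =
  cast refl refl (⌜⌝-++-ʳ++ (encode (instantiate s φ)) _) (sum (length (encode φ)) (factor s) (factor s′) (offset s) (offset s′))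
    (basic ⨾ compile-runs s φ ⨾ compile-runs s′ φ)
  where
  sum : ∀ n f f′ o o′ → 1 + ((n * f + o) + (n * f′ + o′)) ≡ n * (f + f′) + (1 + (o + o′))
  sum = solve-∀
compile-runs (s ⇒ˢ s′)  φ =
  cast refl refl (⌜⌝-++-ʳ++ (encode (instantiate s φ)) _) (sum (length (encode φ)) (factor s) (factor s′) (offset s) (offset s′))
    (basic ⨾ compile-runs s φ ⨾ compile-runs s′ φ)
  where
  sum : ∀ n f f′ o o′ → 1 + ((n * f + o) + (n * f′ + o′)) ≡ n * (f + f′) + (1 + (o + o′))
  sum = solve-∀
compile-runs (∀ˢ v s)   φ =
  cast refl refl refl (sum (length (encode φ)) (factor s) (offset s)) (basic ⨾ basic ⨾ compile-runs s φ)
  where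
  sum : ∀ n f o → 1 + (1 + (n * f + o)) ≡ n * f + (2 + o)
  sum = solve-∀

-- The encoding of a formula is never empty, so its length absorbs the additive costs, `6` from
-- `prepare` and `offset s`, into the factor.
instantiate-linearTime : ∀ {I : Set} (s : Schema) (f : I → Formula) →
                         LinearTimeComputable (encode ∘ f) (encode ∘ instantiate s ∘ f)
instantiate-linearTime s f =
  machine (prepare ⨾ compile s) , 4 + factor s + (6 + offset s) , λ i → bound (f i)
  where
  arith : ∀ n f o → (suc n * 4 + 6) + (suc n * f + o) + n * (6 + o) ≡ (4 + f + (6 + o)) * suc n
  arith = solve-∀

  nonempty : ∀ φ → ∃[ t ] ∃[ w ] encode φ ≡ t ∷ w
  nonempty (atom (unary _ _))    = _ , _ , refl
  nonempty (atom (binary _ _ _)) = _ , _ , refl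
  nonempty (atom (equal _ _))    = _ , _ , refl
  nonempty ⊤ᶠ       = _ , _ , refl
  nonempty ⊥ᶠ       = _ , _ , refl
  nonempty (¬ᶠ _)   = _ , _ , refl
  nonempty (_ ∧ᶠ _) = _ , _ , refl
  nonempty (_ ∨ᶠ _) = _ , _ , refl
  nonempty (_ ⇒ᶠ _) = _ , _ , refl
  nonempty (∀ᶠ _ _) = _ , _ , refl
  nonempty (∃ᶠ _ _) = _ , _ , refl

  P = prepare ⨾ compile s

  Bounded : Formula → List Token → Set
  Bounded φ u = TuringMachine.Computes_⟼_within_ (machine P) u (encode (instantiate s φ)) ((4 + factor s + (6 + offset s)) * length u)

  bound-∷ : ∀ φ {t w} → encode φ ≡ t ∷ w → Bounded φ (t ∷ w)
  bound-∷ φ {t} {w} eq =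
    computes P {t ∷ w}
      (weaken (≤-trans (m≤m+n _ (length w * (6 + offset s))) (≤-reflexive (arith (length w) (factor s) (offset s))))
        (prepare-runs t w ⨾
          subst (λ u → Runs (compile s) (rewound u , []) (rewound u , ⌜ encode (instantiate s φ) ⌝ ʳ++ []) (length u * factor s + offset s)) eq (compile-runs s φ)))

  bound : ∀ φ → Bounded φ (encode φ)
  bound φ = let _ , _ , eq = nonempty φ in subst (Bounded φ) (sym eq) (bound-∷ φ eq)

-- The axioms about names and links

indices : List ℕ
-- Bit 0 is the interpretation of the symbol, bits 1 to 3 are for the vectors `type`, `step` and
-- `choice` of a code, bits 4 and 5 for its phases. Bit 0 can differ from `type`, because a code may
-- denote a witness of the bearer of its type.
indices = upTo 6

-- x and y have the same bits, those of x being named by f and those of y by g.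

agreeAt : (ℕ → Name) → (ℕ → Name) → ℕ → Formula
agreeAt f g i = atom (unary (f i) x) ⇔ᶠ atom (unary (g i) y)

agree : (ℕ → Name) → (ℕ → Name) → Formula
agree f g = ⋀ (map (agreeAt f g) indices)

-- The first conjunct provides, for an element with name e and source s, one with name s and source
-- e that is linked with it in both directions. The relations between s and e are then stored both
-- ways, and both ways stem from one pair of elements.
linkage : Schema
linkage =
     fixed (∀ᶠ x (∃ᶠ y (linkedᶠ x y ∧ᶠ linkedᶠ y x)))
  ∧ˢ ∀ˢ x (∀ˢ y
     (  (fixed (sameᶠ x y) ⇒ˢ each (agree ownTag ownTag))
     ∧ˢ (each (agree ownTag ownTag) ⇒ˢ fixed (sameᶠ x y))
     ∧ˢ (fixed (linkedᶠ x y) ⇒ˢ each (agree ownTag sourceTag))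
     ∧ˢ (fixed (linkedᶠ x y) ⇒ˢ each (atom (binary relationTag x y) ⇔ᶠ atom (unary pairTag y)))
     ∧ˢ (fixed (sameᶠ x y) ⇒ˢ each (agree sourceTag sourceTag) ⇒ˢ
           each (atom (unary pairTag x) ⇔ᶠ atom (unary pairTag y)))))

reduction : Schema
reduction = translated ∧ˢ linkage

reduce : DisplayedSentence → Formula
reduce Ψ = instantiate reduction (sentence Ψ)

-- Counting the predicate symbols

unaryTags : List Name
unaryTags = pairTag ∷ map ownTag indices ++ map sourceTag indices

-- One invariant serves twice: `⊥` at equality yields `reduction-equalityFree`, and the two lists
-- bound the numbers of symbols in `reduction-size`.
BuiltFrom : List Name → Atom → Set
BuiltFrom ws (unary U v)    = U ∈ concatMap (λ w → map (_++ w) unaryTags) ws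
BuiltFrom ws (binary R u v) = R ∈ [] ∷ (false ∷ []) ∷ map (relationTag ++_) ws
BuiltFrom ws (equal u v)    = ⊥

module _ {P : Atom → Set} where

  all-⋀ : ∀ {A : Set} (f : A → Formula) {as} → All (All P ∘ atoms ∘ f) as → All P (atoms (⋀ (map f as)))
  all-⋀ f []         = []
  all-⋀ f (pa ∷ pas) = All.++⁺ pa (all-⋀ f pas)

  all-rename : ∀ f φ → All (P ∘ renameAtom f) (atoms φ) → All P (atoms (rename f φ))
  all-rename f (atom a) (p ∷ []) = p ∷ []
  all-rename f ⊤ᶠ       p = []
  all-rename f ⊥ᶠ       p = []
  all-rename f (¬ᶠ φ)   p = all-rename f φ p
  all-rename f (φ ∧ᶠ ψ) p = All.++⁺ (all-rename f φ (All.++⁻ˡ (atoms φ) p)) (all-rename f ψ (All.++⁻ʳ (atoms φ) p))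
  all-rename f (φ ∨ᶠ ψ) p = All.++⁺ (all-rename f φ (All.++⁻ˡ (atoms φ) p)) (all-rename f ψ (All.++⁻ʳ (atoms φ) p))
  all-rename f (φ ⇒ᶠ ψ) p = All.++⁺ (all-rename f φ (All.++⁻ˡ (atoms φ) p)) (all-rename f ψ (All.++⁻ʳ (atoms φ) p))
  all-rename f (∀ᶠ _ φ) p = all-rename f φ p
  all-rename f (∃ᶠ _ φ) p = all-rename f φ p

  all-forEach : ∀ θ ws → (∀ {w} → w ∈ ws → All (P ∘ renameAtom (_++ w)) (atoms θ)) → All P (atoms (forEach θ ws))
  all-forEach θ ws p = all-⋀ _ (All.tabulate λ w∈ → all-rename _ θ (p w∈))

  all-agree : ∀ {f g} → All (λ i → P (unary (f i) x) × P (unary (g i) y)) indices → All P (atoms (agree f g))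
  all-agree {f} {g} ps = all-⋀ (agreeAt f g) (All.map (λ (p , q) → p ∷ q ∷ q ∷ p ∷ []) ps)

module _ {ws : List Name} where

  private
    tagged : ∀ {t w} → w ∈ ws → t ∈ unaryTags → (t ++ w) ∈ concatMap (λ w → map (_++ w) unaryTags) ws
    tagged {w = w} w∈ t∈ = ∈-concatMap⁺ _ (Any.map (λ { refl → ∈-map⁺ (_++ w) t∈ }) w∈)

    own∈ : ∀ {i} → i ∈ indices → ownTag i ∈ unaryTags
    own∈ i∈ = there (∈-++⁺ˡ (∈-map⁺ ownTag i∈))

    source∈ : ∀ {i} → i ∈ indices → sourceTag i ∈ unaryTags
    source∈ i∈ = there (∈-++⁺ʳ (map ownTag indices) (∈-map⁺ sourceTag i∈))

  builtFrom-translate : ∀ φ → symbols φ ⊆ ws → All (BuiltFrom ws) (atoms (translate φ))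
  builtFrom-translate (atom (unary U v))    sub = tagged (sub (here refl)) (own∈ (here refl)) ∷ []
  builtFrom-translate (atom (binary R u v)) sub = there (there (∈-map⁺ _ (sub (here refl)))) ∷ []
  builtFrom-translate (atom (equal u v))    sub = here refl ∷ []
  builtFrom-translate ⊤ᶠ       sub = []
  builtFrom-translate ⊥ᶠ       sub = []
  builtFrom-translate (¬ᶠ φ)   sub = builtFrom-translate φ sub
  builtFrom-translate (φ ∧ᶠ ψ) sub rewrite mapMaybe-++ symbol (atoms φ) (atoms ψ) =
    All.++⁺ (builtFrom-translate φ (sub ∘ ∈-++⁺ˡ)) (builtFrom-translate ψ (sub ∘ ∈-++⁺ʳ (symbols φ)))
  builtFrom-translate (φ ∨ᶠ ψ) sub rewrite mapMaybe-++ symbol (atoms φ) (atoms ψ) =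
    All.++⁺ (builtFrom-translate φ (sub ∘ ∈-++⁺ˡ)) (builtFrom-translate ψ (sub ∘ ∈-++⁺ʳ (symbols φ)))
  builtFrom-translate (φ ⇒ᶠ ψ) sub rewrite mapMaybe-++ symbol (atoms φ) (atoms ψ) =
    All.++⁺ (builtFrom-translate φ (sub ∘ ∈-++⁺ˡ)) (builtFrom-translate ψ (sub ∘ ∈-++⁺ʳ (symbols φ)))
  builtFrom-translate (∀ᶠ v φ) sub = builtFrom-translate φ sub
  builtFrom-translate (∃ᶠ v φ) sub = there (here refl) ∷ builtFrom-translate φ sub

  builtFrom-reduction : ∀ φ → symbols φ ⊆ ws → All (BuiltFrom ws) (atoms (instantiate reduction φ))
  builtFrom-reduction φ sub =
    All.++⁺ (builtFrom-translate φ sub)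
      (there (here refl) ∷ there (here refl) ∷
        All.++⁺ (here refl ∷ own≈own)
          (All.++⁺ (All.++⁺ own≈own (here refl ∷ []))
            (All.++⁺ (there (here refl) ∷ agreement own∈ source∈)
              (All.++⁺ (there (here refl) ∷ all-forEach _ (symbols φ) (λ w∈ →
                          relation (sub w∈) ∷ pair (sub w∈) ∷ pair (sub w∈) ∷ relation (sub w∈) ∷ []))
                (here refl ∷ All.++⁺ (agreement source∈ source∈) (all-forEach _ (symbols φ) (λ w∈ →
                   pair (sub w∈) ∷ pair (sub w∈) ∷ pair (sub w∈) ∷ pair (sub w∈) ∷ [])))))))
    where
    agreement : ∀ {f g} → (∀ {i} → i ∈ indices → f i ∈ unaryTags) → (∀ {i} → i ∈ indices → g i ∈ unaryTags) →
                All (BuiltFrom ws) (atoms (forEach (agree f g) (symbols φ)))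
    agreement f∈ g∈ = all-forEach _ (symbols φ) (λ w∈ →
      all-agree (All.tabulate (λ i∈ → tagged (sub w∈) (f∈ i∈) , tagged (sub w∈) (g∈ i∈))))
    own≈own = agreement own∈ own∈
    relation : ∀ {w} → w ∈ ws → relationTag ++ w ∈ [] ∷ (false ∷ []) ∷ map (relationTag ++_) ws
    relation w∈ = there (there (∈-map⁺ _ w∈))
    pair : ∀ {w} → w ∈ ws → pairTag ++ w ∈ concatMap (λ w → map (_++ w) unaryTags) ws
    pair w∈ = tagged w∈ (here refl)

reduction-equalityFree : ∀ φ → EqualityFree (instantiate reduction φ)
reduction-equalityFree φ = All.map (λ { b u v refl → b }) (builtFrom-reduction φ id)

∈-mapMaybe⁺ : ∀ {A B : Set} (f : A → Maybe B) {a b as} → a ∈ as → f a ≡ just b → b ∈ mapMaybe f as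
∈-mapMaybe⁺ f {a} {as = as} a∈ eq =
  Any.mapMaybe⁺ f as (Any.map⁺ (Any.map (λ { refl → subst (MaybeAny.Any _) (sym eq) (MaybeAny.just refl) }) a∈))

∈-mapMaybe⁻ : ∀ {A B : Set} (f : A → Maybe B) {b} as → b ∈ mapMaybe f as → ∃[ a ] a ∈ as × f a ≡ just b
∈-mapMaybe⁻ f (a ∷ as) b∈ with f a in eq
∈-mapMaybe⁻ f (a ∷ as) (here refl) | just _ = a , here refl , eq
∈-mapMaybe⁻ f (a ∷ as) (there b∈)  | just _ with ∈-mapMaybe⁻ f as b∈
... | a′ , a′∈ , eq′ = a′ , there a′∈ , eq′
∈-mapMaybe⁻ f (a ∷ as) b∈          | nothing with ∈-mapMaybe⁻ f as b∈
... | a′ , a′∈ , eq′ = a′ , there a′∈ , eq′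

unique-⊆⇒length≤ : ∀ {A : Set} {as bs : List A} → Unique as → as ⊆ bs → length as ≤ length bs
unique-⊆⇒length≤ []             sub = z≤n
unique-⊆⇒length≤ {as = a ∷ as} (a∉as ∷ unique) sub with ∈-∃++ (sub (here refl))
... | ps , qs , refl = begin
  suc (length as)             ≤⟨ s≤s (unique-⊆⇒length≤ unique remaining) ⟩
  suc (length (ps ++ qs))     ≡⟨ cong suc (length-++ ps) ⟩
  suc (length ps + length qs) ≡⟨ +-suc (length ps) (length qs) ⟨
  length ps + suc (length qs) ≡⟨ length-++ ps ⟨
  length (ps ++ a ∷ qs)       ∎
  where
  open ≤-Reasoning
  remaining : as ⊆ ps ++ qs
  remaining b∈ with ∈-++⁻ ps (sub (there b∈))
  ... | inj₁ b∈ps         = ∈-++⁺ˡ b∈ps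
  ... | inj₂ (here refl)  = ⊥-elim (All.lookup a∉as b∈ refl)
  ... | inj₂ (there b∈qs) = ∈-++⁺ʳ ps b∈qs

-- Of the `16`, 13 are the unary tags (one pair tag, six own, six source) and one is the relation
-- tag. The remaining 2 are the symbols for sameness and links, charged to the at least one symbol
-- of `φ`.
reduction-size : ∀ φ → 1 ≤ #unary φ + #binary φ →
                 #unary (instantiate reduction φ) + #binary (instantiate reduction φ) ≤ 16 * (#unary φ + #binary φ)
reduction-size φ 1≤n = begin
  #unary φ′ + #binary φ′
    ≤⟨ +-mono-≤ (unique-⊆⇒length≤ (deduplicate-! _) unary⊆) (unique-⊆⇒length≤ (deduplicate-! _) binary⊆) ⟩
  length (concatMap (λ w → map (_++ w) unaryTags) ws) + (2 + length (map (relationTag ++_) ws))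
    ≡⟨ cong₂ (λ m n → m + (2 + n)) (length-unary ws) (length-map _ ws) ⟩
  13 * length ws + (2 + length ws)
    ≡⟨ cong (λ n → 13 * n + (2 + n)) (length-++ us) ⟩
  13 * n + (2 + n)
    ≤⟨ +-monoʳ-≤ (13 * n) (+-monoˡ-≤ n (*-monoʳ-≤ 2 1≤n)) ⟩
  13 * n + (2 * n + n)
    ≡⟨ arith n ⟩
  16 * n ∎
  where
  open ≤-Reasoning
  φ′ = instantiate reduction φ
  us = deduplicate _≟-Name_ (mapMaybe unarySymbol (atoms φ))
  bs = deduplicate _≟-Name_ (mapMaybe binarySymbol (atoms φ))
  ws = us ++ bs
  n = #unary φ + #binary φ

  arith : ∀ n → 13 * n + (2 * n + n) ≡ 16 * n
  arith = solve-∀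

  length-unary : ∀ ws → length (concatMap (λ w → map (_++ w) unaryTags) ws) ≡ 13 * length ws
  length-unary []       = refl
  length-unary (w ∷ ws) = trans (cong (13 +_) (length-unary ws)) (sym (*-suc 13 (length ws)))

  symbols⊆ws : symbols φ ⊆ ws
  symbols⊆ws w∈ with ∈-mapMaybe⁻ symbol (atoms φ) w∈
  ... | unary U v    , a∈ , refl = ∈-++⁺ˡ (∈-deduplicate⁺ _≟-Name_ (∈-mapMaybe⁺ unarySymbol a∈ refl))
  ... | binary R u v , a∈ , refl = ∈-++⁺ʳ us (∈-deduplicate⁺ _≟-Name_ (∈-mapMaybe⁺ binarySymbol a∈ refl))

  built : All (BuiltFrom ws) (atoms φ′)
  built = builtFrom-reduction φ symbols⊆ws

  unary⊆ : deduplicate _≟-Name_ (mapMaybe unarySymbol (atoms φ′)) ⊆ concatMap (λ w → map (_++ w) unaryTags) ws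
  unary⊆ w∈ with ∈-mapMaybe⁻ unarySymbol (atoms φ′) (∈-deduplicate⁻ _≟-Name_ _ w∈)
  ... | unary U v , a∈ , refl = All.lookup built a∈

  binary⊆ : deduplicate _≟-Name_ (mapMaybe binarySymbol (atoms φ′)) ⊆ [] ∷ (false ∷ []) ∷ map (relationTag ++_) ws
  binary⊆ w∈ with ∈-mapMaybe⁻ binarySymbol (atoms φ′) (∈-deduplicate⁻ _≟-Name_ _ w∈)
  ... | binary R u v , a∈ , refl = All.lookup built a∈

-- The reduction yields closed formulas

foldr₁-elim : (P : Formula → Set) → (∀ {φ ψ} → P φ → P ψ → P (φ ∧ᶠ ψ)) →
              ∀ (f : Name → Formula) b bs → (∀ {w} → w ∈ b ∷ bs → P (f w)) →
              P (List⁺.foldr₁ _∧ᶠ_ (List⁺.map f (b ∷ bs)))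
foldr₁-elim P _∧_ f b []        p = p (here refl)
foldr₁-elim P _∧_ f b (b′ ∷ bs) p = p (here refl) ∧ foldr₁-elim P _∧_ f b′ bs (p ∘ there)

free-translate : ∀ φ {v} → QuantifierFree φ → v FreeIn translate φ → v FreeIn φ
free-translate (atom (unary U u))     qf       v∈ = v∈
free-translate (atom (binary R u u′)) qf       v∈ = v∈
free-translate (atom (equal u u′))    qf       v∈ = v∈
free-translate (¬ᶠ φ)   qf        v∈        = free-translate φ qf v∈
free-translate (φ ∧ᶠ ψ) (qf , _)  (inj₁ v∈) = inj₁ (free-translate φ qf v∈)
free-translate (φ ∧ᶠ ψ) (_ , qf)  (inj₂ v∈) = inj₂ (free-translate ψ qf v∈)
free-translate (φ ∨ᶠ ψ) (qf , _)  (inj₁ v∈) = inj₁ (free-translate φ qf v∈)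
free-translate (φ ∨ᶠ ψ) (_ , qf)  (inj₂ v∈) = inj₂ (free-translate ψ qf v∈)
free-translate (φ ⇒ᶠ ψ) (qf , _)  (inj₁ v∈) = inj₁ (free-translate φ qf v∈)
free-translate (φ ⇒ᶠ ψ) (_ , qf)  (inj₂ v∈) = inj₂ (free-translate ψ qf v∈)

reduce-closed : ∀ Ψ → IsSentence (reduce Ψ)
reduce-closed Ψ v = λ where
    (inj₁ (inj₁ (v≢x , v∈)))       → γ-closed v v≢x v∈
    (inj₁ (inj₂ (inj₁ v∈)))        → both-bound v v∈
    (inj₁ (inj₂ (inj₂ v∈)))        → foldr₁-elim (λ φ → ¬ (v FreeIn translate φ)) (λ p q → [ p , q ]′) _ (List⁺.head β) (List⁺.tail β)
                                       (λ _ → both-bound v) v∈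
    (inj₂ (inj₁ v∈))               → both-bound v v∈
    (inj₂ (inj₂ v∈))               → both-bound v v∈
  where
  open DisplayedSentence Ψ
  both-bound : ∀ v {A : Set} → ¬ (v ≢ x × v ≢ y × A)
  both-bound x (v≢x , _)     = v≢x refl
  both-bound y (_ , v≢y , _) = v≢y refl
  γ-closed : ∀ v → v ≢ x → ¬ (v FreeIn translate γ)
  γ-closed x v≢x _  = v≢x refl
  γ-closed y _   v∈ = γ-variables (free-translate γ γ-quantifierFree v∈)

-- Semantics of the reduction

module _ (M : Structure) {ρ : Assignment M} where

  holds-⋀ : ∀ {A : Set} (f : A → Formula) as → Holds M ρ (⋀ (map f as)) ⇔ (∀ {a} → a ∈ as → Holds M ρ (f a))
  holds-⋀ f as = mk⇔ (⇒ as) (⇐ as)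
    where
    ⇒ : ∀ as → Holds M ρ (⋀ (map f as)) → ∀ {a} → a ∈ as → Holds M ρ (f a)
    ⇒ (_ ∷ as) (h , _)  (here refl) = h
    ⇒ (_ ∷ as) (_ , hs) (there a∈)  = ⇒ as hs a∈
    ⇐ : ∀ as → (∀ {a} → a ∈ as → Holds M ρ (f a)) → Holds M ρ (⋀ (map f as))
    ⇐ []       h = tt
    ⇐ (_ ∷ as) h = h (here refl) , ⇐ as (h ∘ there)

  holds-foldr₁ : ∀ (f : Name → Formula) b bs →
                 Holds M ρ (List⁺.foldr₁ _∧ᶠ_ (List⁺.map f (b ∷ bs))) → ∀ {w} → w ∈ b ∷ bs → Holds M ρ (f w)
  holds-foldr₁ f b []        h        (here refl) = h
  holds-foldr₁ f b (b′ ∷ bs) (h , _)  (here refl) = h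
  holds-foldr₁ f b (b′ ∷ bs) (_ , hs) (there w∈)  = holds-foldr₁ f b′ bs hs w∈

module _ (N : Structure) where
  open Structure N

  Agree : List Name → (ℕ → Name) → (ℕ → Name) → Carrier → Carrier → Set
  Agree ws f g a b = ∀ w i → w ∈ ws → i ∈ indices → ⟦ f i ++ w ⟧₁ a ⇔ ⟦ g i ++ w ⟧₁ b

  private
    holds-⇔ : ∀ {ρ} φ ψ → Holds N ρ (φ ⇔ᶠ ψ) ⇔ (Holds N ρ φ ⇔ Holds N ρ ψ)
    holds-⇔ φ ψ = mk⇔ (λ (⇒ , ⇐) → mk⇔ ⇒ ⇐) (λ eq → to eq , from eq)

  holds-forEach : ∀ {ρ} θ ws → Holds N ρ (forEach θ ws) ⇔ (∀ {w} → w ∈ ws → Holds N ρ (rename (_++ w) θ))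
  holds-forEach θ ws = holds-⋀ N (λ w → rename (_++ w) θ) ws

  holds-forEach-⇔ : ∀ {ρ} a b ws → Holds N ρ (forEach (atom a ⇔ᶠ atom b) ws) ⇔
    (∀ w → w ∈ ws → HoldsAtom N ρ (renameAtom (_++ w) a) ⇔ HoldsAtom N ρ (renameAtom (_++ w) b))
  holds-forEach-⇔ {ρ} a b ws = mk⇔ ⇒ ⇐
    where
    ⇒ : Holds N ρ (forEach (atom a ⇔ᶠ atom b) ws) →
        ∀ w → w ∈ ws → HoldsAtom N ρ (renameAtom (_++ w) a) ⇔ HoldsAtom N ρ (renameAtom (_++ w) b)
    ⇒ h w w∈ = to (holds-⇔ (atom (renameAtom (_++ w) a)) (atom (renameAtom (_++ w) b))) (to (holds-forEach _ ws) h w∈)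
    ⇐ : (∀ w → w ∈ ws → HoldsAtom N ρ (renameAtom (_++ w) a) ⇔ HoldsAtom N ρ (renameAtom (_++ w) b)) →
        Holds N ρ (forEach (atom a ⇔ᶠ atom b) ws)
    ⇐ h = from (holds-forEach (atom a ⇔ᶠ atom b) ws) (λ {w} w∈ →
            from (holds-⇔ (atom (renameAtom (_++ w) a)) (atom (renameAtom (_++ w) b))) (h w w∈))

  holds-agree : ∀ f g ws {a b} → Holds N (a , b) (forEach (agree f g) ws) ⇔ Agree ws f g a b
  holds-agree f g ws {a} {b} = mk⇔ ⇒ ⇐
    where
    f′ g′ : Name → ℕ → Name
    f′ w i = f i ++ w
    g′ w i = g i ++ w
    renamed : ∀ w is → rename (_++ w) (⋀ (map (agreeAt f g) is)) ≡ ⋀ (map (agreeAt (f′ w) (g′ w)) is)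
    renamed w []       = refl
    renamed w (i ∷ is) = cong (agreeAt (f′ w) (g′ w) i ∧ᶠ_) (renamed w is)
    ⇒ : Holds N (a , b) (forEach (agree f g) ws) → Agree ws f g a b
    ⇒ h w i w∈ i∈ =
      to (holds-⇔ (atom (unary (f i ++ w) x)) (atom (unary (g i ++ w) y)))
         (to (holds-⋀ N (agreeAt (f′ w) (g′ w)) indices)
             (subst (Holds N (a , b)) (renamed w indices) (to (holds-forEach (agree f g) ws) h w∈)) i∈)
    ⇐ : Agree ws f g a b → Holds N (a , b) (forEach (agree f g) ws)
    ⇐ h = from (holds-forEach (agree f g) ws) (λ {w} w∈ →
            subst (Holds N (a , b)) (sym (renamed w indices))
              (from (holds-⋀ N (agreeAt (f′ w) (g′ w)) indices) (λ {i} i∈ →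
                from (holds-⇔ (atom (unary (f i ++ w) x)) (atom (unary (g i ++ w) y))) (h w i w∈ i∈))))

  infix 4 _≈_ _⟶_
  _≈_ _⟶_ : Carrier → Carrier → Set
  a ≈ b = ⟦ [] ⟧₂ a b
  a ⟶ b = ⟦ false ∷ [] ⟧₂ a b

  record Linking (ws : List Name) : Set where
    field
      returns  : ∀ a → ∃[ b ] (a ⟶ b × b ⟶ a)
      ≈⇔agree  : ∀ a b → a ≈ b ⇔ Agree ws ownTag ownTag a b
      ⟶⇒agree : ∀ a b → a ⟶ b → Agree ws ownTag sourceTag a b
      relation : ∀ a b → a ⟶ b → ∀ w → w ∈ ws → ⟦ relationTag ++ w ⟧₂ a b ⇔ ⟦ pairTag ++ w ⟧₁ b
      pair     : ∀ a b → a ≈ b → Agree ws sourceTag sourceTag a b → ∀ w → w ∈ ws → ⟦ pairTag ++ w ⟧₁ a ⇔ ⟦ pairTag ++ w ⟧₁ b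

  holds-reduction : ∀ φ → N ⊨ instantiate reduction φ ⇔ (N ⊨ translate φ × Linking (symbols φ))
  holds-reduction φ = mk⇔ (λ h → (λ ρ → proj₁ (h ρ)) , linking {nonempty , nonempty} (proj₂ (h (nonempty , nonempty))))
                          (λ (h , l) ρ → h ρ , holds {ρ} l)
    where
    ws = symbols φ
    linking : ∀ {ρ} → Holds N ρ (instantiate linkage φ) → Linking ws
    linking (m , h) = record
      { returns  = m
      ; ≈⇔agree  = λ a b → let same , same′ , _ = h a b in
                    mk⇔ (λ a≈b → to (holds-agree ownTag ownTag ws) (same a≈b)) (λ ag → same′ (from (holds-agree ownTag ownTag ws) ag))
      ; ⟶⇒agree = λ a b a⟶b → let _ , _ , l , _ = h a b in to (holds-agree ownTag sourceTag ws) (l a⟶b)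
      ; relation = λ a b a⟶b → let _ , _ , _ , r , _ = h a b in to (holds-forEach-⇔ _ _ ws) (r a⟶b)
      ; pair     = λ a b a≈b ag → let _ , _ , _ , _ , p = h a b in
                    to (holds-forEach-⇔ _ _ ws) (p a≈b (from (holds-agree sourceTag sourceTag ws) ag))
      }
    holds : ∀ {ρ} → Linking ws → Holds N ρ (instantiate linkage φ)
    holds l = returns , λ a b →
        (λ a≈b → from (holds-agree ownTag ownTag ws) (to (≈⇔agree a b) a≈b))
      , (λ ag → from (≈⇔agree a b) (to (holds-agree ownTag ownTag ws) ag))
      , (λ a⟶b → from (holds-agree ownTag sourceTag ws) (⟶⇒agree a b a⟶b))
      , (λ a⟶b → from (holds-forEach-⇔ _ _ ws) (relation a b a⟶b))
      , (λ a≈b ag → from (holds-forEach-⇔ _ _ ws) (pair a b a≈b (to (holds-agree sourceTag sourceTag ws) ag)))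
      where open Linking l

module _ (M : Structure) {ρ : Assignment M} (N : Structure) {ρ′ : Assignment N} where

  holds-translate : ∀ φ → QuantifierFree φ →
                    (∀ {a} → a ∈ atoms φ → HoldsAtom M ρ a ⇔ HoldsAtom N ρ′ (translateAtom a)) →
                    Holds M ρ φ ⇔ Holds N ρ′ (translate φ)
  holds-translate (atom a) qf eq = eq (here refl)
  holds-translate ⊤ᶠ       qf eq = mk⇔ id id
  holds-translate ⊥ᶠ       qf eq = mk⇔ id id
  holds-translate (¬ᶠ φ)   qf eq = let h = holds-translate φ qf eq in mk⇔ (_∘ from h) (_∘ to h)
  holds-translate (φ ∧ᶠ ψ) (qf , qf′) eq =
    let h  = holds-translate φ qf (eq ∘ ∈-++⁺ˡ)
        h′ = holds-translate ψ qf′ (eq ∘ ∈-++⁺ʳ (atoms φ))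
    in mk⇔ (λ (p , q) → to h p , to h′ q) (λ (p , q) → from h p , from h′ q)
  holds-translate (φ ∨ᶠ ψ) (qf , qf′) eq =
    let h  = holds-translate φ qf (eq ∘ ∈-++⁺ˡ)
        h′ = holds-translate ψ qf′ (eq ∘ ∈-++⁺ʳ (atoms φ))
    in mk⇔ [ inj₁ ∘ to h , inj₂ ∘ to h′ ]′ [ inj₁ ∘ from h , inj₂ ∘ from h′ ]′
  holds-translate (φ ⇒ᶠ ψ) (qf , qf′) eq =
    let h  = holds-translate φ qf (eq ∘ ∈-++⁺ˡ)
        h′ = holds-translate ψ qf′ (eq ∘ ∈-++⁺ʳ (atoms φ))
    in mk⇔ (λ f → to h′ ∘ f ∘ from h) (λ f → from h′ ∘ f ∘ to h)

free-occurring : ∀ φ {a v} → QuantifierFree φ → a ∈ atoms φ → v OccursIn a → v FreeIn φ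
free-occurring (atom a) qf (here refl) v∈ = v∈
free-occurring (¬ᶠ φ)   qf a∈ v∈ = free-occurring φ qf a∈ v∈
free-occurring (φ ∧ᶠ ψ) (qf , qf′) a∈ v∈ with ∈-++⁻ (atoms φ) a∈
... | inj₁ a∈φ = inj₁ (free-occurring φ qf a∈φ v∈)
... | inj₂ a∈ψ = inj₂ (free-occurring ψ qf′ a∈ψ v∈)
free-occurring (φ ∨ᶠ ψ) (qf , qf′) a∈ v∈ with ∈-++⁻ (atoms φ) a∈
... | inj₁ a∈φ = inj₁ (free-occurring φ qf a∈φ v∈)
... | inj₂ a∈ψ = inj₂ (free-occurring ψ qf′ a∈ψ v∈)
free-occurring (φ ⇒ᶠ ψ) (qf , qf′) a∈ v∈ with ∈-++⁻ (atoms φ) a∈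
... | inj₁ a∈φ = inj₁ (free-occurring φ qf a∈φ v∈)
... | inj₂ a∈ψ = inj₂ (free-occurring ψ qf′ a∈ψ v∈)

module Conjuncts (Ψ : DisplayedSentence) where
  open DisplayedSentence Ψ renaming (sentence to Ψ-sentence)

  ws : List Name
  ws = symbols Ψ-sentence

  witnessed : Name → Formula
  witnessed βᵢ = ∀ᶠ x (∃ᶠ y (atom (binary βᵢ x y) ∧ᶠ x ≠ᶠ y))

  βs : List Name
  βs = List⁺.toList β

  private
    atoms-β : ∀ b bs {w} → w ∈ b ∷ bs → binary w x y ∈ atoms (List⁺.foldr₁ _∧ᶠ_ (List⁺.map witnessed (b ∷ bs)))
    atoms-β b []        (here refl) = here refl
    atoms-β b (b′ ∷ bs) (here refl) = here refl
    atoms-β b (b′ ∷ bs) (there w∈)  = there (there (atoms-β b′ bs w∈))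

    symbol∈ : ∀ {a w} → a ∈ atoms Ψ-sentence → symbol a ≡ just w → w ∈ ws
    symbol∈ = ∈-mapMaybe⁺ symbol

  βs⊆ws : βs ⊆ ws
  βs⊆ws w∈ = symbol∈ (∈-++⁺ʳ (atoms γ) (there (∈-++⁺ʳ (atoms α) (atoms-β (List⁺.head β) (List⁺.tail β) w∈)))) refl

  module _ (M N : Structure) where
    private
      module M = Structure M
      module N = Structure N

    SameUnary : M.Carrier → N.Carrier → Set
    SameUnary a a′ = ∀ U → U ∈ ws → M.⟦ U ⟧₁ a ⇔ N.⟦ ownTag 0 ++ U ⟧₁ a′

    SameBinary : M.Carrier → M.Carrier → N.Carrier → N.Carrier → Set
    SameBinary a b a′ b′ = ∀ R → R ∈ ws → M.⟦ R ⟧₂ a b ⇔ N.⟦ relationTag ++ R ⟧₂ a′ b′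

    γ-translate : ∀ {a b a′ b′} → SameUnary a a′ → Holds M (a , b) γ ⇔ Holds N (a′ , b′) (translate γ)
    γ-translate {a} {b} {a′} {b′} same = holds-translate M N γ γ-quantifierFree λ {at} → agrees at
      where
      y∉ : ∀ {at} → at ∈ atoms γ → ¬ (y OccursIn at)
      y∉ at∈ y∈ = γ-variables (free-occurring γ γ-quantifierFree at∈ y∈)
      agrees : ∀ at → at ∈ atoms γ → HoldsAtom M (a , b) at ⇔ HoldsAtom N (a′ , b′) (translateAtom at)
      agrees (unary U x)    at∈ = same U (symbol∈ (∈-++⁺ˡ at∈) refl)
      agrees (unary U y)    at∈ = ⊥-elim (y∉ at∈ refl)
      agrees (binary R x x) at∈ = ⊥-elim (All.lookup γ-loopFree at∈ R x refl)
      agrees (binary R x y) at∈ = ⊥-elim (y∉ at∈ (inj₂ refl))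
      agrees (binary R y v) at∈ = ⊥-elim (y∉ at∈ (inj₁ refl))
      agrees (equal u v)    at∈ = ⊥-elim (All.lookup γ-equalityFree at∈ u v refl)

    α-translate : ∀ {a b a′ b′} → SameUnary a a′ → SameUnary b b′ → SameBinary a b a′ b′ → SameBinary b a b′ a′ →
                  Holds M (a , b) α ⇔ Holds N (a′ , b′) (translate α)
    α-translate {a} {b} {a′} {b′} a~ b~ ab~ ba~ = holds-translate M N α α-quantifierFree λ {at} → agrees at
      where
      ∈ws : ∀ {at w} → at ∈ atoms α → symbol at ≡ just w → w ∈ ws
      ∈ws at∈ = symbol∈ (∈-++⁺ʳ (atoms γ) (there (∈-++⁺ˡ at∈)))
      agrees : ∀ at → at ∈ atoms α → HoldsAtom M (a , b) at ⇔ HoldsAtom N (a′ , b′) (translateAtom at)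
      agrees (unary U x)    at∈ = a~ U (∈ws at∈ refl)
      agrees (unary U y)    at∈ = b~ U (∈ws at∈ refl)
      agrees (binary R x x) at∈ = ⊥-elim (All.lookup α-loopFree at∈ R x refl)
      agrees (binary R x y) at∈ = ab~ R (∈ws at∈ refl)
      agrees (binary R y x) at∈ = ba~ R (∈ws at∈ refl)
      agrees (binary R y y) at∈ = ⊥-elim (All.lookup α-loopFree at∈ R y refl)
      agrees (equal u v)    at∈ = ⊥-elim (All.lookup α-equalityFree at∈ u v refl)

  record Displayed (M : Structure) : Set where
    open Structure M
    field
      γ-holds : ∀ a b → Holds M (a , b) γ
      α-holds : ∀ a b → a ≢ b → Holds M (a , b) α
      β-holds : ∀ w → w ∈ βs → ∀ a → ∃[ b ] (⟦ w ⟧₂ a b × a ≢ b)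

  record DisplayedTranslation (N : Structure) : Set where
    open Structure N
    field
      γ-holds : ∀ a b → Holds N (a , b) (translate γ)
      α-holds : ∀ a b → ¬ (_≈_ N a b) → Holds N (a , b) (translate α)
      β-holds : ∀ w → w ∈ βs → ∀ a → ∃[ b ] (_⟶_ N a b × ⟦ relationTag ++ w ⟧₂ a b × ¬ (_≈_ N a b))

  holds-displayed : ∀ M → M ⊨ Ψ-sentence ⇔ Displayed M
  holds-displayed M = mk⇔
    (λ h → record
      { γ-holds = λ a b → proj₁ (h (a , b)) a
      ; α-holds = λ a b → proj₁ (proj₂ (h (a , b))) a b
      ; β-holds = λ w w∈ a → holds-foldr₁ M witnessed (List⁺.head β) (List⁺.tail β) (proj₂ (proj₂ (h (a , a)))) w∈ a
      })
    (λ d (a , b) → let open Displayed d in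
        (λ c → γ-holds c b) , α-holds
      , foldr₁-elim (Holds M (a , b)) _,_ witnessed (List⁺.head β) (List⁺.tail β) (λ {w} w∈ → β-holds w w∈))

  private
    translate-foldr₁ : ∀ b bs → translate (List⁺.foldr₁ _∧ᶠ_ (List⁺.map witnessed (b ∷ bs))) ≡
                                List⁺.foldr₁ _∧ᶠ_ (List⁺.map (translate ∘ witnessed) (b ∷ bs))
    translate-foldr₁ b []        = refl
    translate-foldr₁ b (b′ ∷ bs) = cong (translate (witnessed b) ∧ᶠ_) (translate-foldr₁ b′ bs)

  holds-displayedTranslation : ∀ N → N ⊨ translate Ψ-sentence ⇔ DisplayedTranslation N
  holds-displayedTranslation N = mk⇔
    (λ h → record
      { γ-holds = λ a b → proj₁ (h (a , b)) a
      ; α-holds = λ a b → proj₁ (proj₂ (h (a , b))) a b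
      ; β-holds = λ w w∈ a → holds-foldr₁ N (translate ∘ witnessed) (List⁺.head β) (List⁺.tail β)
                               (subst (Holds N (a , a)) (translate-foldr₁ (List⁺.head β) (List⁺.tail β)) (proj₂ (proj₂ (h (a , a))))) w∈ a
      })
    (λ d (a , b) → let open DisplayedTranslation d in
        (λ c → γ-holds c b) , α-holds
      , foldr₁-elim (Holds N (a , b) ∘ translate) _,_ witnessed (List⁺.head β) (List⁺.tail β) (λ {w} w∈ → β-holds w w∈))

-- Truth values by excluded middle

module Classical (em : ExcludedMiddle 0ℓ) where

  truth : Set → Bool
  truth P = does (em {P})

  truth-≡ : ∀ {P Q} → truth P ≡ truth Q ⇔ (P ⇔ Q)
  truth-≡ {P} {Q} with em {P} | em {Q}
  ... | yes p | yes q = mk⇔ (λ _ → mk⇔ (const q) (const p)) (const refl)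
  ... | yes p | no ¬q = mk⇔ (λ ()) (λ eq → ⊥-elim (¬q (to eq p)))
  ... | no ¬p | yes q = mk⇔ (λ ()) (λ eq → ⊥-elim (¬p (from eq q)))
  ... | no ¬p | no ¬q = mk⇔ (λ _ → mk⇔ (⊥-elim ∘ ¬p) (⊥-elim ∘ ¬q)) (const refl)

  profile : ∀ {A : Set} → List A → (A → Set) → List Bool
  profile as P = map (truth ∘ P) as

  profile-≡ : ∀ {A : Set} (as : List A) {P Q} → profile as P ≡ profile as Q ⇔ (∀ a → a ∈ as → P a ⇔ Q a)
  profile-≡ as {P} {Q} = mk⇔ (⇒ as) (λ eq → map-cong-local (All.tabulate (λ {a} a∈ → from truth-≡ (eq a a∈))))
    where
    ⇒ : ∀ as → profile as P ≡ profile as Q → ∀ a → a ∈ as → P a ⇔ Q a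
    ⇒ (_ ∷ as) eq _ (here refl) = to truth-≡ (proj₁ (∷-injective eq))
    ⇒ (_ ∷ as) eq a (there a∈)  = ⇒ as (proj₂ (∷-injective eq)) a a∈

  -- Hedberg's theorem, excluded middle making equality decidable. It identifies elements of `Named`
  -- that differ only in their equality proofs.
  ≡-unique : ∀ {A : Set} {a b : A} (p q : a ≡ b) → p ≡ q
  ≡-unique = Decidable⇒UIP.≡-irrelevant (λ _ _ → em)

-- From a model N of the reduction to a model of the sentence: its elements are the
-- names that occur in N, each represented by one element bearing it.

module Quotient (em : ExcludedMiddle 0ℓ) (Ψ : DisplayedSentence) (N : Structure)
                (N-translation : Conjuncts.DisplayedTranslation Ψ N)
                (N-linking : Linking N (Conjuncts.ws Ψ)) where
  open Classical em
  open Conjuncts Ψ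
  open Structure N
  open DisplayedTranslation N-translation
  open Linking N-linking

  bits : (ℕ → Name) → Carrier → List Bool
  bits f a = profile (cartesianProduct ws indices) (λ (w , i) → ⟦ f i ++ w ⟧₁ a)

  own source : Carrier → List Bool
  own    = bits ownTag
  source = bits sourceTag

  agree⇔bits : ∀ f g a b → Agree N ws f g a b ⇔ bits f a ≡ bits g b
  agree⇔bits f g a b = mk⇔
    (λ ag → from (profile-≡ pairs) (λ (w , i) wi∈ → let w∈ , i∈ = ∈-cartesianProduct⁻ ws indices wi∈ in ag w i w∈ i∈))
    (λ eq w i w∈ i∈ → to (profile-≡ pairs) eq (w , i) (∈-cartesianProduct⁺ w∈ i∈))
    where pairs = cartesianProduct ws indices

  ≈⇔own : ∀ a b → _≈_ N a b ⇔ own a ≡ own b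
  ≈⇔own a b = ⇔.trans (≈⇔agree a b) (agree⇔bits ownTag ownTag a b)

  ⟶⇒own≡source : ∀ {a b} → _⟶_ N a b → own a ≡ source b
  ⟶⇒own≡source a⟶b = to (agree⇔bits ownTag sourceTag _ _) (⟶⇒agree _ _ a⟶b)

  bearer : List Bool → Carrier
  bearer v with em {∃[ a ] own a ≡ v}
  ... | yes (a , _) = a
  ... | no _        = nonempty

  canonical : Carrier → Carrier
  canonical = bearer ∘ own

  own-canonical : ∀ a → own (canonical a) ≡ own a
  own-canonical a with em {∃[ b ] own b ≡ own a}
  ... | yes (_ , eq) = eq
  ... | no ¬∃        = ⊥-elim (¬∃ (a , refl))

  Named : Set
  Named = ∃[ a ] canonical a ≡ a

  named : Carrier → Named
  named a = canonical a , cong bearer (own-canonical a)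

  named-injective : ∀ {a b : Named} → own (proj₁ a) ≡ own (proj₁ b) → a ≡ b
  named-injective {a , p} {b , q} eq = lemma (trans (sym p) (trans (cong bearer eq) q)) p q
    where
    lemma : ∀ {a b} → a ≡ b → (p : canonical a ≡ a) (q : canonical b ≡ b) → (a , p) ≡ (b , q)
    lemma refl p q = cong (_ ,_) (≡-unique p q)

  Joined : Carrier → Carrier → Carrier → Set
  Joined a b c = source c ≡ own a × own c ≡ own b

  -- The bits of the elements that join a to b determine the relations between the
  -- two names; without such elements the representatives do.

  Related : Name → Carrier → Carrier → Set
  Related w a b with em {∃[ c ] Joined a b c}
  ... | yes (c , _) = ⟦ pairTag ++ w ⟧₁ c
  ... | no _        = ⟦ relationTag ++ w ⟧₂ a b

  model : Structure
  model = record
    { Carrier  = Named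
    ; nonempty = named nonempty
    ; ⟦_⟧₁     = λ U (a , _) → ⟦ ownTag 0 ++ U ⟧₁ a
    ; ⟦_⟧₂     = λ R (a , _) (b , _) → Related R a b
    }

  -- The axiom `pair` makes the choice of the joining element immaterial: any two of them agree in
  -- name and in source.
  related-joined : ∀ {a b c} → Joined a b c → ∀ w → w ∈ ws → Related w a b ⇔ ⟦ pairTag ++ w ⟧₁ c
  related-joined {a} {b} {c} (sc , oc) w w∈ with em {∃[ c ] Joined a b c}
  ... | yes (d , sd , od) = pair d c (from (≈⇔own d c) (trans od (sym oc)))
                              (from (agree⇔bits sourceTag sourceTag d c) (trans sd (sym sc))) w w∈
  ... | no ¬joined        = ⊥-elim (¬joined (c , sc , oc))

  related-unjoined : ∀ {a b} → ¬ (∃[ c ] Joined a b c) → ∀ w → Related w a b ⇔ ⟦ relationTag ++ w ⟧₂ a b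
  related-unjoined {a} {b} ¬joined w with em {∃[ c ] Joined a b c}
  ... | yes joined = ⊥-elim (¬joined joined)
  ... | no _       = mk⇔ id id

  -- The target of a link joins the two names, and the axiom `relation` says that its bits store the
  -- actual relations of the link.
  related-⟶ : ∀ {a b c d} → _⟶_ N c d → own c ≡ own a → own d ≡ own b →
               ∀ w → w ∈ ws → Related w a b ⇔ ⟦ relationTag ++ w ⟧₂ c d
  related-⟶ c⟶d oc od w w∈ =
    ⇔.trans (related-joined (trans (sym (⟶⇒own≡source c⟶d)) oc , od) w w∈) (⇔.sym (relation _ _ c⟶d w w∈))

  -- Both directions have to come from a single pair of elements, since `α` speaks of both at once.
  -- If `c` joins `a` to `b`, then `returns` gives a `d` bearing the name of `a`, linked with `c`
  -- both ways, and each of the two stores one direction. By the same axiom, if no element joins `a`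
  -- to `b`, none joins `b` to `a`, so the representatives decide both directions.
  realised : ∀ a b → ∃[ a′ ] ∃[ b′ ] own a′ ≡ own a × own b′ ≡ own b ×
             (∀ w → w ∈ ws → Related w a b ⇔ ⟦ relationTag ++ w ⟧₂ a′ b′) ×
             (∀ w → w ∈ ws → Related w b a ⇔ ⟦ relationTag ++ w ⟧₂ b′ a′)
  realised a b = by-cases em
    where
    by-cases : Dec (∃[ c ] Joined a b c) → _
    by-cases (yes (c , sc , oc)) =
      let d , c⟶d , d⟶c = returns c
          od = trans (⟶⇒own≡source d⟶c) sc
      in d , c , od , oc , related-⟶ d⟶c od oc , related-⟶ c⟶d oc od
    by-cases (no ¬joined) =
      a , b , refl , refl , (λ w _ → related-unjoined ¬joined w) , (λ w _ → related-unjoined ¬joined′ w)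
      where
      ¬joined′ : ¬ (∃[ c ] Joined b a c)
      ¬joined′ (c , sc , oc) =
        let d , c⟶d , d⟶c = returns c
        in ¬joined (d , trans (sym (⟶⇒own≡source c⟶d)) oc , trans (⟶⇒own≡source d⟶c) sc)

  sameUnary : ∀ a a′ → own a′ ≡ own (proj₁ a) → SameUnary model N a a′
  sameUnary a a′ eq U U∈ = from (agree⇔bits ownTag ownTag _ _) (sym eq) U 0 U∈ (here refl)

  model-displayed : Displayed model
  model-displayed = record
    { γ-holds = λ a b → from (γ-translate model N {b = b} (sameUnary a (proj₁ a) refl)) (γ-holds (proj₁ a) (proj₁ a))
    ; α-holds = λ a b a≢b →
        let a′ , b′ , oa , ob , ab , ba = realised (proj₁ a) (proj₁ b)
        in from (α-translate model N (sameUnary a a′ oa) (sameUnary b b′ ob) ab ba)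
             (α-holds a′ b′ (λ a′≈b′ → a≢b (named-injective (trans (sym oa) (trans (to (≈⇔own a′ b′) a′≈b′) ob)))))
    ; β-holds = λ w w∈ a →
        let c , a⟶c , R , a≉c = β-holds w w∈ (proj₁ a)
        in named c , from (related-⟶ a⟶c refl (sym (own-canonical c)) w (βs⊆ws w∈)) R
                   , λ eq → a≉c (from (≈⇔own _ _) (trans (cong (own ∘ proj₁) eq) (own-canonical c)))
    }

-- Small models

bitAt : (ns : List Name) → Vec Bool (length ns) → Name → Bool
bitAt []       []      w = false
bitAt (n ∷ ns) (b ∷ v) w = if does (w ≟-Name n) then b else bitAt ns v w

bitAt-injective : ∀ {ns} → Unique ns → ∀ v v′ → (∀ w → w ∈ ns → bitAt ns v w ≡ bitAt ns v′ w) → v ≡ v′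
bitAt-injective {[]}     []           []      []        eq = refl
bitAt-injective {n ∷ ns} (n∉ ∷ unique) (b ∷ v) (b′ ∷ v′) eq = cong₂ _∷_ b≡b′ (bitAt-injective unique v v′ rest)
  where
  b≡b′ : b ≡ b′
  b≡b′ with n ≟-Name n | eq n (here refl)
  ... | yes _  | e = e
  ... | no n≢n | _ = ⊥-elim (n≢n refl)
  rest : ∀ w → w ∈ ns → bitAt ns v w ≡ bitAt ns v′ w
  rest w w∈ with w ≟-Name n | eq w (there w∈)
  ... | yes refl | _ = ⊥-elim (All.lookup n∉ w∈ refl)
  ... | no _     | e = e

select : (ns : List Name) → Vec Bool (length ns) → Maybe Name
select []       []          = nothing
select (n ∷ ns) (true ∷ v)  = just n
select (n ∷ ns) (false ∷ v) = select ns v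

selector : ∀ {ns : List Name} {w} → w ∈ ns → Vec Bool (length ns)
selector (here _)   = true ∷ Vec.replicate _ false
selector (there w∈) = false ∷ selector w∈

select-selector : ∀ {ns w} (w∈ : w ∈ ns) → select ns (selector w∈) ≡ just w
select-selector (here refl) = refl
select-selector (there w∈)  = select-selector w∈

select-none : (ns : List Name) → select ns (Vec.replicate _ false) ≡ nothing
select-none []       = refl
select-none (_ ∷ ns) = select-none ns

-- The lexicographic order with `true` first; it serves to orient the pairs of codes that no arrow
-- orients.
precedes : ∀ {n} → Vec Bool n → Vec Bool n → Bool
precedes []          []          = true
precedes (true ∷ u)  (true ∷ v)  = precedes u v
precedes (true ∷ u)  (false ∷ v) = true
precedes (false ∷ u) (true ∷ v)  = false
precedes (false ∷ u) (false ∷ v) = precedes u v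

precedes-total : ∀ {n} (u v : Vec Bool n) → precedes u v ≡ true ⊎ precedes v u ≡ true
precedes-total []          []          = inj₁ refl
precedes-total (true ∷ u)  (true ∷ v)  = precedes-total u v
precedes-total (true ∷ u)  (false ∷ v) = inj₁ refl
precedes-total (false ∷ u) (true ∷ v)  = inj₂ refl
precedes-total (false ∷ u) (false ∷ v) = precedes-total u v

precedes-antisym : ∀ {n} (u v : Vec Bool n) → precedes u v ≡ true → precedes v u ≡ true → u ≡ v
precedes-antisym []          []          _ _ = refl
precedes-antisym (true ∷ u)  (true ∷ v)  p q = cong (true ∷_) (precedes-antisym u v p q)
precedes-antisym (false ∷ u) (false ∷ v) p q = cong (false ∷_) (precedes-antisym u v p q)

-- With a the bearer of the 1-type type, a code denotes a itself if step selects no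
-- name, and otherwise the witness of a for the name that step selects.  A code that
-- is not a king serves as the witness, for the name that choice selects, of the
-- codes of the previous phase.

record Code (n : ℕ) : Set where
  constructor code
  field
    type step choice : Vec Bool n
    phase₁ phase₂    : Bool

private
  code-≡ : ∀ {n} {c c′ : Code n} → let open Code in type c ≡ type c′ → step c ≡ step c′ → choice c ≡ choice c′ →
           phase₁ c ≡ phase₁ c′ → phase₂ c ≡ phase₂ c′ → c ≡ c′
  code-≡ refl refl refl refl refl = refl

  bitVector : ∀ {n} → Code n → Vec Bool _
  bitVector (code t s c p q) = t Vec.++ s Vec.++ c Vec.++ p ∷ q ∷ []

  bitVector-injective : ∀ {n} (c c′ : Code n) → bitVector c ≡ bitVector c′ → c ≡ c′
  bitVector-injective (code t s c p q) (code t′ s′ c′ p′ q′) eq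
    with refl , eq₁ ← Vec.++-injective t t′ eq
    with refl , eq₂ ← Vec.++-injective s s′ eq₁
    with refl , refl ← Vec.++-injective c c′ eq₂ = refl

-- Kings, and the elements that codes denote

module SmallModel (em : ExcludedMiddle 0ℓ) (Ψ : DisplayedSentence) (M : Structure)
             (M-displayed : Conjuncts.Displayed Ψ M)
             (ns : List Name) (ns-unique : Unique ns)
             (ws⊆ns : Conjuncts.ws Ψ ⊆ ns) (ns⊆ws : ns ⊆ Conjuncts.ws Ψ) where
  open Classical em
  open Conjuncts Ψ
  open Structure M
  open Displayed M-displayed

  Bits : Set
  Bits = Vec Bool (length ns)

  none : Bits
  none = Vec.replicate (length ns) false

  typeOf : Carrier → Bits
  typeOf a = Vec.map (λ w → truth (⟦ w ⟧₁ a)) (Vec.fromList ns)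

  typeOf-≡ : ∀ {a b} → typeOf a ≡ typeOf b → ∀ w → w ∈ ws → ⟦ w ⟧₁ a ⇔ ⟦ w ⟧₁ b
  typeOf-≡ {a} {b} eq w w∈ = to truth-≡ (pointwise ns eq (ws⊆ns w∈))
    where
    pointwise : ∀ ns → Vec.map (λ w → truth (⟦ w ⟧₁ a)) (Vec.fromList ns) ≡ Vec.map (λ w → truth (⟦ w ⟧₁ b)) (Vec.fromList ns) →
                ∀ {w} → w ∈ ns → truth (⟦ w ⟧₁ a) ≡ truth (⟦ w ⟧₁ b)
    pointwise (_ ∷ ns) eq (here refl) = proj₁ (Vec.∷-injective eq)
    pointwise (_ ∷ ns) eq (there w∈)  = pointwise ns (proj₂ (Vec.∷-injective eq)) w∈

  bearer : Bits → Carrier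
  bearer v with em {∃[ a ] typeOf a ≡ v}
  ... | yes (a , _) = a
  ... | no _        = nonempty

  typeOf-bearer : ∀ a → typeOf (bearer (typeOf a)) ≡ typeOf a
  typeOf-bearer a with em {∃[ b ] typeOf b ≡ typeOf a}
  ... | yes (_ , eq) = eq
  ... | no ¬∃        = ⊥-elim (¬∃ (a , refl))

  King : Carrier → Set
  King a = ∀ b → typeOf b ≡ typeOf a → b ≡ a

  bearer-king : ∀ {a} → King a → bearer (typeOf a) ≡ a
  bearer-king {a} king = king _ (typeOf-bearer a)

  double : Carrier → Carrier
  double a with em {∃[ b ] (typeOf b ≡ typeOf a × b ≢ a)}
  ... | yes (b , _) = b
  ... | no _        = a

  double-spec : ∀ {a} → ¬ King a → typeOf (double a) ≡ typeOf a × double a ≢ a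
  double-spec {a} ¬king with em {∃[ b ] (typeOf b ≡ typeOf a × b ≢ a)}
  ... | yes (_ , spec) = spec
  ... | no ¬∃          = ⊥-elim (¬king λ b eq → case em {b ≡ a} of λ where
                           (yes b≡a) → b≡a
                           (no b≢a)  → ⊥-elim (¬∃ (b , eq , b≢a)))

  witness : Name → Carrier → Carrier
  witness w a with w ∈? βs
  ... | yes w∈ = proj₁ (β-holds w w∈ a)
  ... | no _   = a

  witness-spec : ∀ {w} → w ∈ βs → ∀ a → ⟦ w ⟧₂ a (witness w a) × a ≢ witness w a
  witness-spec {w} w∈ a with w ∈? βs
  ... | yes w∈′ = proj₂ (β-holds w w∈′ a)
  ... | no w∉   = ⊥-elim (w∉ w∈)

  follow : Maybe Name → Carrier → Carrier
  follow nothing  a = a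
  follow (just w) a = witness w a

  Codes : Set
  Codes = Code (length ns)

  open Code

  rep : Codes → Carrier
  rep c = follow (select ns (step c)) (bearer (type c))

  plain : Carrier → Codes
  plain a = code (typeOf a) none none false false

  rep-unstepped : ∀ c → step c ≡ none → rep c ≡ bearer (type c)
  rep-unstepped c eq = cong (λ s → follow s (bearer (type c))) (trans (cong (select ns) eq) (select-none ns))

  rep-plain : ∀ {a} → King a → rep (plain a) ≡ a
  rep-plain {a} king = trans (rep-unstepped (plain a) refl) (bearer-king king)

  -- A king has a single code in normal form.

  normal : Codes → Codes
  normal c with em {King (rep c)}
  ... | yes _ = plain (rep c)
  ... | no _  = c

  normal-king : ∀ {c} → King (rep c) → normal c ≡ plain (rep c)
  normal-king {c} king with em {King (rep c)}
  ... | yes _    = refl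
  ... | no ¬king = ⊥-elim (¬king king)

  normal-commoner : ∀ {c} → ¬ King (rep c) → normal c ≡ c
  normal-commoner {c} ¬king with em {King (rep c)}
  ... | yes king = ⊥-elim (¬king king)
  ... | no _     = refl

  rep-normal : ∀ c → rep (normal c) ≡ rep c
  rep-normal c with em {King (rep c)}
  ... | yes king = rep-plain king
  ... | no _     = refl

  kings-normal : ∀ {c c′} → King (rep c) → rep c ≡ rep c′ → normal c ≡ normal c′
  kings-normal king eq = trans (normal-king king) (trans (cong plain eq) (sym (normal-king (subst King eq king))))

  normal-idempotent : ∀ c → normal (normal c) ≡ normal c
  normal-idempotent c with em {King (rep c)} in eq
  ... | yes king = trans (normal-king (subst King (sym (rep-plain king)) king)) (cong plain (rep-plain king))
  ... | no ¬king = normal-commoner ¬king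

  -- Arrow p q: in the small model q is the witness of p that choice q asks for.  The
  -- phases run through a cycle of length 4, so no two codes are related both ways.

  Arrow : Codes → Codes → Set
  Arrow p q = ¬ King (rep p) × ¬ King (rep q) × phase₁ q ≡ not (phase₂ p) × phase₂ q ≡ phase₁ p ×
              typeOf (follow (select ns (choice q)) (rep p)) ≡ typeOf (rep q) ×
              rep p ≢ follow (select ns (choice q)) (rep p)

  -- Following an arrow turns the phases `(p₁ , p₂)` into `(not p₂ , p₁)`; doing so twice negates
  -- both bits, hence never leads back.
  arrow-asym : ∀ {p q} → Arrow p q → ¬ Arrow q p
  arrow-asym {code _ _ _ p₁ p₂} (_ , _ , refl , refl , _) (_ , _ , p₁≡ , p₂≡ , _) = no-2-cycle p₁ p₂ p₁≡ p₂≡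
    where
    no-2-cycle : ∀ p q → p ≡ not p → q ≡ not q → ⊥
    no-2-cycle true  _ ()
    no-2-cycle false _ ()

  -- Each pair of distinct codes gets one orientation, and the relations in both directions are
  -- copied along it. An arrow overrides the order, because what it copies has to be the witness.
  Forward : Codes → Codes → Set
  Forward p q = Arrow p q ⊎ (¬ Arrow q p × precedes (bitVector p) (bitVector q) ≡ true)

  forward-total : ∀ p q → ¬ Forward p q → Forward q p
  forward-total p q ¬f = case em {Arrow q p} of λ where
    (yes q→p) → inj₁ q→p
    (no ¬q→p) → inj₂ (¬f ∘ inj₁ , Sum.[ (λ p≤q → ⊥-elim (¬f (inj₂ (¬q→p , p≤q)))) , id ]′
                                     (precedes-total (bitVector p) (bitVector q)))

  forward-antisym : ∀ p q → Forward p q → Forward q p → p ≡ q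
  forward-antisym p q (inj₁ p→q)          (inj₁ q→p)          = ⊥-elim (arrow-asym p→q q→p)
  forward-antisym p q (inj₁ p→q)          (inj₂ (¬p→q , _))   = ⊥-elim (¬p→q p→q)
  forward-antisym p q (inj₂ (¬q→p , _))   (inj₁ q→p)          = ⊥-elim (¬q→p q→p)
  forward-antisym p q (inj₂ (_ , p≤q))    (inj₂ (_ , q≤p))    =
    bitVector-injective p q (precedes-antisym (bitVector p) (bitVector q) p≤q q≤p)

  -- The small model copies the relations between p and q from those between the
  -- two elements realise p q of M.

  target : Codes → Codes → Carrier
  target p q with em {Arrow p q} | em {rep p ≡ rep q}
  ... | yes _ | _     = follow (select ns (choice q)) (rep p)
  -- Distinct codes may denote one element, whereas `α` is only known for distinct elements. If the
  -- normal forms differ, that element is a commoner, so its double, of the same type, stands in.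
  ... | no _  | yes _ = double (rep p)
  ... | no _  | no _  = rep q

  realise : Codes → Codes → Carrier × Carrier
  realise p q with em {Forward p q}
  ... | yes _ = rep p , target p q
  ... | no _  = target q p , rep q

  target-spec : ∀ {p q} → normal p ≢ normal q → typeOf (target p q) ≡ typeOf (rep q) × rep p ≢ target p q
  target-spec {p} {q} p≢q with em {Arrow p q} | em {rep p ≡ rep q}
  ... | yes (_ , _ , _ , _ , same , distinct) | _ = same , distinct
  ... | no _ | yes eq = let same , distinct = double-spec (λ king → p≢q (kings-normal king eq))
                        in trans same (cong typeOf eq) , distinct ∘ sym
  ... | no _ | no neq = refl , neq

  realise-swap : ∀ p q → normal p ≢ normal q → realise q p ≡ swap (realise p q)
  realise-swap p q p≢q with em {Forward p q} | em {Forward q p}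
  ... | yes f | yes b = ⊥-elim (p≢q (cong normal (forward-antisym p q f b)))
  ... | yes f | no _  = refl
  ... | no _  | yes _ = refl
  ... | no ¬f | no ¬b = ⊥-elim (¬b (forward-total p q ¬f))

  record Realises (p q : Codes) (ab : Carrier × Carrier) : Set where
    field
      type₁    : typeOf (proj₁ ab) ≡ typeOf (rep p)
      type₂    : typeOf (proj₂ ab) ≡ typeOf (rep q)
      distinct : proj₁ ab ≢ proj₂ ab

  realises : ∀ p q → normal p ≢ normal q → Realises p q (realise p q)
  realises p q p≢q with em {Forward p q}
  ... | yes _ = let same , distinct = target-spec p≢q in record { type₁ = refl ; type₂ = same ; distinct = distinct }
  ... | no _  = let same , distinct = target-spec (p≢q ∘ sym) in record { type₁ = same ; type₂ = refl ; distinct = distinct ∘ sym }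

  realise-arrow : ∀ {p q} → Arrow p q → realise p q ≡ (rep p , follow (select ns (choice q)) (rep p))
  realise-arrow {p} {q} p→q with em {Forward p q}
  ... | no ¬f = ⊥-elim (¬f (inj₁ p→q))
  ... | yes _ with em {Arrow p q} | em {rep p ≡ rep q}
  ...   | yes _   | _ = refl
  ...   | no ¬p→q | _ = ⊥-elim (¬p→q p→q)

  target-unlinked : ∀ {p q} → ¬ Arrow p q → rep p ≢ rep q → target p q ≡ rep q
  target-unlinked {p} {q} ¬p→q neq with em {Arrow p q} | em {rep p ≡ rep q}
  ... | yes p→q | _      = ⊥-elim (¬p→q p→q)
  ... | no _    | yes eq = ⊥-elim (neq eq)
  ... | no _    | no _   = refl

  -- Arrows and doubles involve commoners only, so a king's relations to other elements are those of
  -- `M`. For this reason a king's witnesses need codes that denote those very elements.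
  realise-king : ∀ {p q} → King (rep p) ⊎ King (rep q) → rep p ≢ rep q → realise p q ≡ (rep p , rep q)
  realise-king {p} {q} king neq with em {Forward p q}
  ... | yes _ = cong (rep p ,_) (target-unlinked (unlinked king) neq)
    where
    unlinked : King (rep p) ⊎ King (rep q) → ¬ Arrow p q
    unlinked (inj₁ k) (¬k , _)     = ¬k k
    unlinked (inj₂ k) (_ , ¬k , _) = ¬k k
  ... | no _  = cong (_, rep q) (target-unlinked (unlinked king) (neq ∘ sym))
    where
    unlinked : King (rep p) ⊎ King (rep q) → ¬ Arrow q p
    unlinked (inj₁ k) (_ , ¬k , _) = ¬k k
    unlinked (inj₂ k) (¬k , _)     = ¬k k

  Related : Name → Codes → Codes → Set
  Related w p q = ⟦ w ⟧₂ (proj₁ (realise p q)) (proj₂ (realise p q))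

  -- If the witness `b` is a king, its plain code serves. If only `a` is a king, the code must
  -- denote `b` itself, which `step` achieves from the type of `a`. Between commoners it is enough
  -- to have a code of the type of `b`, reserved for `w` by `choice` and placed in the phase after
  -- that of `p`.
  small-witness : ∀ w → w ∈ βs → ∀ p → normal p ≡ p → ∃[ q ] (normal p ≢ normal q × Related w p (normal q))
  small-witness w w∈ p p-normal = by-cases em em
    where
    a = rep p
    b = witness w a
    a≢b : a ≢ b
    a≢b = proj₂ (witness-spec w∈ a)
    w∈ns : w ∈ ns
    w∈ns = ws⊆ns (βs⊆ws w∈)

    via : ∀ {q c d} → realise p q ≡ (c , d) → ⟦ w ⟧₂ c d → Related w p q
    via eq = subst (λ (c , d) → ⟦ w ⟧₂ c d) (sym eq)

    royal : ∀ q → rep q ≡ b → King a ⊎ King b → ∃[ q ] (normal p ≢ normal q × Related w p (normal q))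
    royal q eq king = q , a≢rep ∘ (λ e → trans (sym (rep-normal p)) (cong rep e)) ,
      via (realise-king (Sum.map₂ (subst King (sym rep≡b)) king) a≢rep)
          (subst (⟦ w ⟧₂ a) (sym rep≡b) (proj₁ (witness-spec w∈ a)))
      where
      rep≡b : rep (normal q) ≡ b
      rep≡b = trans (rep-normal q) eq
      a≢rep : a ≢ rep (normal q)
      a≢rep e = a≢b (trans e rep≡b)

    by-cases : Dec (King a) → Dec (King b) → ∃[ q ] (normal p ≢ normal q × Related w p (normal q))
    by-cases _          (yes king) = royal (plain b) (rep-plain king) (inj₂ king)
    by-cases (yes king) (no _)     = royal (code (typeOf a) (selector w∈ns) none false false)
      (trans (cong (λ s → follow s (bearer (typeOf a))) (select-selector w∈ns)) (cong (witness w) (bearer-king king)))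
      (inj₁ king)
    by-cases (no ¬king) (no ¬king′) = q , p≢q ∘ trans (sym p-normal) ∘ (λ e → trans e q-normal) ,
      subst (Related w p) (sym q-normal)
        (via (realise-arrow {p} {q} p→q) (subst (⟦ w ⟧₂ a) (sym chosen) (proj₁ (witness-spec w∈ a))))
      where
      q : Codes
      q = code (typeOf b) none (selector w∈ns) (not (phase₂ p)) (phase₁ p)
      chosen : follow (select ns (choice q)) a ≡ b
      chosen = cong (λ s → follow s a) (select-selector w∈ns)
      same : typeOf b ≡ typeOf (rep q)
      same = trans (sym (typeOf-bearer b)) (cong typeOf (sym (rep-unstepped q refl)))
      q-commoner : ¬ King (rep q)
      q-commoner king = ¬king′ (subst King (sym (king b same)) king)
      q-normal : normal q ≡ q
      q-normal = normal-commoner q-commoner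
      p→q : Arrow p q
      p→q = ¬king , q-commoner , refl , refl , trans (cong typeOf chosen) same , λ e → a≢b (trans e chosen)
      no-fixed-point : ∀ p₁ p₂ → p₁ ≡ not p₂ → p₂ ≡ p₁ → ⊥
      no-fixed-point true  true  () _
      no-fixed-point true  false _ ()
      no-fixed-point false true  _ ()
      no-fixed-point false false () _
      p≢q : p ≢ q
      p≢q e = no-fixed-point (phase₁ p) (phase₂ p) (cong phase₁ e) (cong phase₂ e)

  -- The model of the reduction: a pair (c , e) bears the name of e and the source c.
  -- The i-th own and source tags end in i ones and a zero.

  codeBit : Name → Codes → Set
  codeBit (false ∷ w)                                  c = ⟦ w ⟧₁ (rep c)
  codeBit (true ∷ false ∷ w)                           c = T (bitAt ns (type c) w)
  codeBit (true ∷ true ∷ false ∷ w)                    c = T (bitAt ns (step c) w)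
  codeBit (true ∷ true ∷ true ∷ false ∷ w)             c = T (bitAt ns (choice c) w)
  -- The phases belong to the code as a whole and are repeated for every symbol.
  codeBit (true ∷ true ∷ true ∷ true ∷ false ∷ w)      c = T (phase₁ c)
  codeBit (true ∷ true ∷ true ∷ true ∷ true ∷ _)       c = T (phase₂ c)
  codeBit _                                            c = ⊥

  unaryInterpretation : Name → Codes × Codes → Set
  unaryInterpretation (true ∷ u)          (c , e) = codeBit u (normal e)
  unaryInterpretation (false ∷ true ∷ u)  (c , e) = codeBit u (normal c)
  unaryInterpretation (false ∷ false ∷ w) (c , e) = Related w (normal c) (normal e)
  unaryInterpretation _                   _       = ⊥

  binaryInterpretation : Name → Codes × Codes → Codes × Codes → Set
  binaryInterpretation []           (c , e) (c′ , e′) = normal e ≡ normal e′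
  binaryInterpretation (true ∷ w)   (c , e) (c′ , e′) = Related w (normal e) (normal e′)
  binaryInterpretation (false ∷ _)  (c , e) (c′ , e′) = normal c′ ≡ normal e

  pairs : Structure
  pairs = record
    { Carrier  = Codes × Codes
    ; nonempty = plain nonempty , plain nonempty
    ; ⟦_⟧₁     = unaryInterpretation
    ; ⟦_⟧₂     = binaryInterpretation
    }

  private
    ⇔-cong : ∀ {A : Set} (P : A → Set) {a b} → a ≡ b → P a ⇔ P b
    ⇔-cong P refl = mk⇔ id id

    T-injective : ∀ {b b′} → T b ⇔ T b′ → b ≡ b′
    T-injective {true}  {true}  _  = refl
    T-injective {true}  {false} eq = ⊥-elim (to eq tt)
    T-injective {false} {true}  eq = ⊥-elim (from eq tt)
    T-injective {false} {false} _  = refl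

  numbered : ℕ → Name → Name
  numbered i w = (replicate i true ∷ʳ false) ++ w

  code-determined : ∀ {c c′} → (∀ w i → w ∈ ws → i ∈ indices → codeBit (numbered i w) c ⇔ codeBit (numbered i w) c′) → c ≡ c′
  code-determined {c} {c′} eq = code-≡
    (vector type (λ w w∈ → eq w 1 w∈ (there (here refl))))
    (vector step (λ w w∈ → eq w 2 w∈ (there (there (here refl)))))
    (vector choice (λ w w∈ → eq w 3 w∈ (there (there (there (here refl))))))
    (T-injective (eq b 4 b∈ (there (there (there (there (here refl)))))))
    (T-injective (eq b 5 b∈ (there (there (there (there (there (here refl))))))))
    where
    -- The phases can be read off at any one symbol, and `β` is a nonempty list.
    b = List⁺.head (DisplayedSentence.β Ψ)
    b∈ : b ∈ ws
    b∈ = βs⊆ws (here refl)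
    vector : (f : Codes → Bits) → (∀ w → w ∈ ws → T (bitAt ns (f c) w) ⇔ T (bitAt ns (f c′) w)) → f c ≡ f c′
    vector f eq = bitAt-injective ns-unique (f c) (f c′) (λ w w∈ → T-injective (eq w (ns⊆ws w∈)))

  -- Exchanging the components of `(c , e)` gives the reverse link, and the pair bits are computed
  -- from the two normal forms alone, hence depend only on the names.
  pairs-linking : Linking pairs ws
  pairs-linking = record
    { returns  = λ (c , e) → (e , c) , refl , refl
    ; ≈⇔agree  = λ (c , e) (c′ , e′) → mk⇔ (λ eq w i _ _ → ⇔-cong (codeBit (numbered i w)) eq) code-determined
    ; ⟶⇒agree = λ (c , e) (c′ , e′) eq w i _ _ → ⇔-cong (codeBit (numbered i w)) (sym eq)
    ; relation = λ (c , e) (c′ , e′) eq w _ → ⇔-cong (λ p → Related w p (normal e′)) (sym eq)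
    ; pair     = λ (c , e) (c′ , e′) eq ag w _ →
        ⇔.trans (⇔-cong (λ p → Related w p (normal e)) (code-determined ag)) (⇔-cong (Related w (normal c′)) eq)
    }

  pairs-translation : DisplayedTranslation pairs
  pairs-translation = record
    { γ-holds = λ (c , e) b → to (γ-translate M pairs {a = rep (normal e)} {b = nonempty} (λ U _ → mk⇔ id id)) (γ-holds _ _)
    ; α-holds = λ (c , e) (c′ , e′) e≢e′ →
        let p = normal e
            q = normal e′
            p≢q : normal p ≢ normal q
            p≢q = λ eq → e≢e′ (trans (sym (normal-idempotent e)) (trans eq (normal-idempotent e′)))
            open Realises (realises p q p≢q)
        in to (α-translate M pairs (typeOf-≡ type₁) (typeOf-≡ type₂) (λ R _ → mk⇔ id id)
                (λ R _ → ⇔-cong (λ (a , b) → ⟦ R ⟧₂ a b) (sym (realise-swap p q p≢q))))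
              (α-holds _ _ distinct)
    ; β-holds = λ w w∈ (c , e) →
        let q , e≢q , related = small-witness w w∈ (normal e) (normal-idempotent e)
        in (e , q) , refl , related , λ eq → e≢q (trans (normal-idempotent e) eq)
    }

reduce-equisatisfiable : ExcludedMiddle 0ℓ → ∀ Ψ → Satisfiable (sentence Ψ) ⇔ Satisfiable (reduce Ψ)
reduce-equisatisfiable em Ψ = mk⇔ forwards backwards
  where
  open Conjuncts Ψ
  forwards : Satisfiable (sentence Ψ) → Satisfiable (reduce Ψ)
  forwards (M , M⊨Ψ) = pairs , from (holds-reduction pairs (sentence Ψ))
      (from (holds-displayedTranslation pairs) pairs-translation , pairs-linking)
    where
    open SmallModel em Ψ M (to (holds-displayed M) M⊨Ψ) (deduplicate _≟-Name_ ws) (deduplicate-! ws)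
                    (∈-deduplicate⁺ _≟-Name_) (∈-deduplicate⁻ _≟-Name_ ws)
  backwards : Satisfiable (reduce Ψ) → Satisfiable (sentence Ψ)
  backwards (N , N⊨Ψ*) = model , from (holds-displayed model) model-displayed
    where
    N-properties = to (holds-reduction N (sentence Ψ)) N⊨Ψ*
    open Quotient em Ψ N (to (holds-displayedTranslation N) (proj₁ N-properties)) (proj₂ N-properties)

mainTheorem6 : Σ[ reduce ∈ (DisplayedSentence → Formula) ]
    LinearTimeComputable (encode ∘ sentence) (encode ∘ reduce)
    × (∀ (Ψ : DisplayedSentence) →
    IsSentence (reduce Ψ)
    × EqualityFree (reduce Ψ)
    × (ExcludedMiddle 0ℓ → Satisfiable (sentence Ψ) ⇔ Satisfiable (reduce Ψ)))
    × (∃[ c ] ∀ (Ψ : DisplayedSentence) →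
    #unary (reduce Ψ) + #binary (reduce Ψ)
    ≤ c * (#unary (sentence Ψ) + #binary (sentence Ψ)))
mainTheorem6 =
    reduce
  , instantiate-linearTime reduction sentence
  , (λ Ψ → reduce-closed Ψ , reduction-equalityFree (sentence Ψ) , λ em → reduce-equisatisfiable em Ψ)
  , 16 , λ Ψ → reduction-size (sentence Ψ) (≤-trans (s≤s z≤n) (≤-trans (DisplayedSentence.m≤k Ψ) (m≤n+m _ _)))
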